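{- The area generating function $PA^{(2)}(q)=\sum_{n\ge1}PA^{(2)}_nq^n$ of 2-sided prudent polygons (where $PA^{(2)}_n$ is the number of 2-sided prudent polygons of area $n$) is $$PA^{(2)}(q)=\frac{2q}{1-2q}+\frac{2q}{1-q},$$ and so the number of such polygons is $PA^{(2)}_n=2^n+2$ for $n\ge1$.
   Context: All walks are on the square lattice $\mathbb{Z}^2$, start at $(0,0)$ and take unit steps north, south, east, west. A walk $\omega$ is prudent if it is self-avoiding and never takes a step towards an already occupied site: if a step goes from $p$ to $p+d$ (with $d$ a unit direction vector), then none of the points $p+kd$, $k\ge1$, has been visited before that step. Let $\omega_i$ be the walk formed by the first $i$ steps and $b_i$ its bounding box (the smallest, possibly degenerate, lattice rectangle containing $\omega_i$). A prudent walk $\omega$ of length $N$ is 2-sided if for each $i=0,1,\dots,N$ the walk $\omega_i$ ends on the north or east side of $b_i$. A prudent polygon is a prudent walk, with more than one step, that ends at a lattice site adjacent to its starting point $(0,0)$; the polygon is the closed curve obtained by adding the edge joining the endpoint to $(0,0)$. Polygons are counted as walks, i.e. they are rooted at $(0,0)$ and oriented. The polygon is 2-sided if the underlying prudent walk is 2-sided. Its area is the number of unit cells enclosed. -}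

module Defs where

open import Data.Integer using (ℤ; +_; 0ℤ; 1ℤ; _+_; _-_; _*_; _⊔_; _⊓_; _≤_; ∣_∣)
open import Data.Integer.Properties using (+-assoc; *-identityʳ; +-0-abelianGroup)
open import Algebra.Properties.AbelianGroup +-0-abelianGroup using (xyx⁻¹≈y)
open import Data.List using (List; []; _∷_; [_]; _++_; length; take; drop; zip; foldr)
open import Data.List.Membership.Propositional using (_∈_; _∉_)
open import Data.List.Relation.Unary.Unique.Propositional using (Unique)
open import Data.Nat as ℕ using (ℕ; zero; suc)
open import Data.Product using (∃-syntax; _×_; _,_; proj₁; proj₂)
open import Data.Sum using (_⊎_)
open import Function using (_∘_; _⇔_)
open import Relation.Binary.Construct.Closure.ReflexiveTransitive using (Star)
open import Relation.Binary.PropositionalEquality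
  using (_≡_; _≗_; refl; sym; trans; cong; module ≡-Reasoning)
open import Relation.Nullary using (¬_)

HasSize : {A : Set} → (A → Set) → ℕ → Set
HasSize P n = ∃[ xs ] Unique xs × length xs ≡ n × (∀ x → x ∈ xs ⇔ P x)

------------------------------------------------------------------------
-- Walks on the square lattice

Site : Set
Site = ℤ × ℤ

data Direction : Set where
  north south east west : Direction

Walk : Set
Walk = List Direction

origin : Site
origin = 0ℤ , 0ℤ

move : ℕ → Direction → Site → Site
move k north (x , y) = x , y + + k
move k south (x , y) = x , y - + k
move k east  (x , y) = x + + k , y
move k west  (x , y) = x - + k , y

sitesFrom : Site → Walk → List Site
sitesFrom p []      = [ p ]
sitesFrom p (d ∷ ω) = p ∷ sitesFrom (move 1 d p) ω

endpointFrom : Site → Walk → Site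
endpointFrom p []      = p
endpointFrom p (d ∷ ω) = endpointFrom (move 1 d p) ω

sites : Walk → List Site
sites = sitesFrom origin

endpoint : Walk → Site
endpoint = endpointFrom origin

SelfAvoiding : Walk → Set
SelfAvoiding ω = Unique (sites ω)

Prudent : Walk → Set
Prudent ω = SelfAvoiding ω ×
  (∀ u d v → ω ≡ u ++ d ∷ v →
   ∀ k → k ℕ.≥ 1 → move k d (endpoint u) ∉ sites u)

------------------------------------------------------------------------
-- Bounding boxes and 2-sidedness

record Box : Set where
  constructor box
  field
    xmin xmax ymin ymax : ℤ

open Box public

extend : Site → Box → Box
extend (x , y) (box x₀ x₁ y₀ y₁) = box (x ⊓ x₀) (x ⊔ x₁) (y ⊓ y₀) (y ⊔ y₁)

-- Starting the fold at the origin adds nothing, as every walk visits it.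
boundingBox : Walk → Box
boundingBox ω = foldr extend (box 0ℤ 0ℤ 0ℤ 0ℤ) (sites ω)

OnNorthSide : Site → Box → Set
OnNorthSide (x , y) b = xmin b ≤ x × x ≤ xmax b × y ≡ ymax b

OnEastSide : Site → Box → Set
OnEastSide (x , y) b = x ≡ xmax b × ymin b ≤ y × y ≤ ymax b

TwoSided : Walk → Set
TwoSided ω = ∀ i → i ℕ.≤ length ω →
  let ωᵢ = take i ω
  in OnNorthSide (endpoint ωᵢ) (boundingBox ωᵢ)
     ⊎ OnEastSide (endpoint ωᵢ) (boundingBox ωᵢ)

------------------------------------------------------------------------
-- Polygons and their area

Adjacent : Site → Site → Set
Adjacent p p′ = ∃[ d ] p′ ≡ move 1 d p

PrudentPolygon : Walk → Set
PrudentPolygon ω = Prudent ω × length ω ℕ.> 1 × Adjacent origin (endpoint ω)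

TwoSidedPrudentPolygon : Walk → Set
TwoSidedPrudentPolygon ω = PrudentPolygon ω × TwoSided ω

Edge : Set
Edge = Site × Site

-- The edges of the closed curve, including the one from the endpoint back
-- to the origin, oriented as they are traversed.
edges : Walk → List Edge
edges ω = zip closed (drop 1 closed)
  where closed = sites ω ++ [ origin ]

OnCurve : Walk → Edge → Set
OnCurve ω (p , p′) = (p , p′) ∈ edges ω ⊎ (p′ , p) ∈ edges ω

-- The cell (x , y) is the unit square [x , x + 1] × [y , y + 1].
Cell : Set
Cell = ℤ × ℤ

side : Direction → Cell → Edge
side north c = move 1 north c , move 1 east (move 1 north c)
side south c = c , move 1 east c
side east  c = move 1 east c , move 1 north (move 1 east c)
side west  c = c , move 1 north c

Open : Walk → Cell → Cell → Set
Open ω c c′ = ∃[ d ] c′ ≡ move 1 d c × ¬ OnCurve ω (side d c)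

-- A cell is enclosed when it lies in a bounded component of the complement
-- of the curve.  A corner of a cell that is not on the curve has all four
-- incident edges off the curve, so connectivity through common sides suffices.
Enclosed : Walk → Cell → Set
Enclosed ω c = ∃[ r ] (∀ c′ → Star (Open ω) c c′ →
  ∣ proj₁ c′ ∣ ℕ.≤ r × ∣ proj₂ c′ ∣ ℕ.≤ r)

HasArea : Walk → ℕ → Set
HasArea ω = HasSize (Enclosed ω)

------------------------------------------------------------------------
-- Formal power series in q with integer coefficients

Series : Set
Series = ℕ → ℤ

infixl 6 _⊕_ _⊖_
infixl 7 _·_ _⊛_

q : Series
q 1 = 1ℤ
q _ = 0ℤ

𝟏 : Series
𝟏 zero    = 1ℤ
𝟏 (suc _) = 0ℤ

_⊕_ _⊖_ : Series → Series → Series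
(f ⊕ g) n = f n + g n
(f ⊖ g) n = f n - g n

_·_ : ℤ → Series → Series
(a · f) n = a * f n

-- Cauchy product: coefficient n is the sum of f i * g (n ∸ i) over i ≤ n.
_⊛_ : Series → Series → Series
(f ⊛ g) zero    = f 0 * g 0
(f ⊛ g) (suc n) = f 0 * g (suc n) + ((f ∘ suc) ⊛ g) n

-- Long division by a series with constant term 1.
_/_[_] : Series → (g : Series) → g 0 ≡ 1ℤ → Series
(f / g [ g₀ ]) zero    = f 0
(f / g [ g₀ ]) (suc n) =
  ((λ k → f (suc k) - f 0 * g (suc k)) / g [ g₀ ]) n

/-⊛-cancel : ∀ f g g₀ → (f / g [ g₀ ]) ⊛ g ≗ f
/-⊛-cancel f g g₀ zero    = trans (cong (f 0 *_) g₀) (*-identityʳ (f 0))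
/-⊛-cancel f g g₀ (suc n) = begin
  a + ((f′ / g [ g₀ ]) ⊛ g) n  ≡⟨ cong (λ z → a + z) (/-⊛-cancel f′ g g₀ n) ⟩
  a + (f (suc n) - a)          ≡⟨ sym (+-assoc a (f (suc n)) _) ⟩
  a + f (suc n) - a            ≡⟨ xyx⁻¹≈y a (f (suc n)) ⟩
  f (suc n)                    ∎
  where
  open ≡-Reasoning
  a  = f 0 * g (suc n)
  f′ : Series
  f′ k = f (suc k) - f 0 * g (suc k)

-- The series of the sum of a n * qⁿ over n ≥ 1; the value a 0 is ignored.
genFun : (ℕ → ℕ) → Series
genFun a zero    = 0ℤ
genFun a (suc n) = + a (suc n)

{-# OPTIONS --safe #-}

-- Up to the reflection x ↔ y the walk starts north or west.  It then stays in
-- the half-plane x ≤ 0, always in the top row of its box, until it crosses to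
-- the column x = 1; prudence and 2-sidedness leave it no way back to the origin
-- other than straight down that column.  Such a walk is a stack of rows of
-- lengths w₁ , … , wₘ ≥ 1 flush with the wall x = 1, that is, a composition of
-- the area n, which gives 2ⁿ⁻¹ walks.  The only walks closing before they cross
-- are the bars going n steps west, one north and n steps east.  With the
-- reflections there are 2 (2ⁿ⁻¹ + 1) polygons of area n.
module Submission where

open import Defs
open import Data.Integer using (ℤ; +_; -[1+_]; 0ℤ; 1ℤ; ∣_∣; +≤+; -≤+; +<+)
import Data.Integer as ℤ
import Data.Integer.Properties as ℤₚ
open import Data.Integer.Tactic.RingSolver using (solve-∀)
open import Data.List using (List; []; _∷_; [_]; _++_; length; take; drop; zip; foldr; map; replicate; upTo)
open import Data.List.Membership.Propositional using (_∈_; _∉_)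
open import Data.List.Membership.Propositional.Properties
  using (∈-map⁺; ∈-map⁻; ∈-++⁺ˡ; ∈-++⁺ʳ; ∈-++⁻; ∈-upTo⁺; ∈-upTo⁻; ∈-∃++)
open import Data.List.Properties
  using (map-∘; map-cong; map-id; length-map; length-++; length-upTo; ++-identityʳ)
open import Data.List.Relation.Unary.All as All using (All; []; _∷_)
import Data.List.Relation.Unary.All.Properties as Allₚ
open import Data.List.Relation.Unary.AllPairs using ([]; _∷_)
open import Data.List.Relation.Unary.Any using (here; there)
open import Data.List.Relation.Unary.Unique.Propositional using (Unique)
import Data.List.Relation.Unary.Unique.Propositional.Properties as Uniqueₚ
open import Data.Nat using (ℕ; zero; suc; pred; _+_; _^_; _≥_; _≤_; _<_; _>_; z≤n; s≤s; s≤s⁻¹;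
  _≤′_; _≤‴_; ≤′-reflexive; ≤′-step; ≤‴-reflexive; ≤‴-step)
open import Data.Nat.ListAction using (sum)
import Data.Nat.Properties as ℕₚ
open import Data.Product using (Σ-syntax; ∃-syntax; _×_; _,_; proj₁; proj₂; map₂; swap)
open import Data.Sum as Sum using (_⊎_; inj₁; inj₂; [_,_]′)
open import Function using (_∘_; _⇔_; mk⇔; Equivalence)
open import Relation.Binary.Construct.Closure.ReflexiveTransitive using (Star; ε; _◅_; _◅◅_; gmap)
open import Relation.Binary.PropositionalEquality
  using (_≡_; _≢_; _≗_; refl; sym; trans; cong; cong₂; subst; subst₂; module ≡-Reasoning)
open import Relation.Nullary using (¬_; contradiction; yes; no)
open Equivalence using (to; from)

-- Why the wall is the only way back. A south step inside x ≤ 0 either points at the origin or ends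
-- below a visited site and left of the origin, hence on neither side of the box. Once (0 , h) and
-- (1 , h) with h ≥ 1 are visited, the only new neighbour of the origin that can still lie on the
-- north or east side is (1 , 0), and a visit to x = 2 spoils it. Climbing above h leaves (1 , h)
-- under the walk, so prudence closes column 1 to a descent, while a south step further left again
-- ends on neither side.
--
-- These arguments run by induction on the rest of the walk, so the conditions on prefixes are
-- recast as `Legal`, which carries the visited sites.
--
-- Enclosure is defined by connectivity of cells. In place of a Jordan curve theorem the region is
-- given explicitly: `Outline` collects what the curve must and may contain for the region to be
-- exactly the set of enclosed cells.

-- Prudence and 2-sidedness as a condition on each step

Top Right Extreme : Site → List Site → Set
Top   p = All (λ s → proj₂ s ℤ.≤ proj₂ p)
Right p = All (λ s → proj₁ s ℤ.≤ proj₁ p)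
Extreme p V = Top p V ⊎ Right p V

Clear : List Site → Site → Direction → Set
Clear V p d = ∀ k → k ≥ 1 → move k d p ∉ V

-- v is a continuation, from p, of a walk that has visited the sites V and ended at p.
data Legal (V : List Site) (p : Site) : Walk → Set where
  stop : Extreme p V → Legal V p []
  step : ∀ {d v} → Extreme p V → Clear V p d →
         Legal (move 1 d p ∷ V) (move 1 d p) v → Legal V p (d ∷ v)

extreme : ∀ {V p v} → Legal V p v → Extreme p V
extreme (stop e)     = e
extreme (step e _ _) = e

start∈ : ∀ p v → p ∈ sitesFrom p v
start∈ p []      = here refl
start∈ p (d ∷ v) = here refl

endpoint∈ : ∀ p v → endpointFrom p v ∈ sitesFrom p v
endpoint∈ p []      = here refl
endpoint∈ p (d ∷ v) = there (endpoint∈ (move 1 d p) v)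

-- Clearance at distance 1 forbids stepping onto a visited site. By induction a later visit to `s`
-- would happen at the very next site, which is then itself in `V`.
revisit : ∀ {V p v s} → Legal V p v → s ∈ V → s ∈ sitesFrom p v → s ≡ p
revisit (stop _)     s∈V (here s≡p) = s≡p
revisit (step _ _ _) s∈V (here s≡p) = s≡p
revisit (step _ c l) s∈V (there m) =
  contradiction (subst (_∈ _) (revisit l (there s∈V) m) s∈V) (c 1 (s≤s z≤n))

legal⇒unique : ∀ {V p v} → p ∈ V → Legal V p v → Unique (sitesFrom p v)
legal⇒unique p∈V (stop _)     = [] ∷ []
legal⇒unique {p = p} p∈V (step {d} {v} _ c l) =
  All.tabulate fresh ∷ legal⇒unique (here refl) l
  where
  fresh : ∀ {s} → s ∈ sitesFrom (move 1 d p) v → p ≢ s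
  fresh m refl with p≡ ← revisit l (there p∈V) m =
    c 1 (s≤s z≤n) (subst (_∈ _) p≡ p∈V)

-- Clearance of the sites since `p` is what is wanted; clearance of `V` is carried along because it
-- covers `p` itself in the induction.
legal⇒clear : ∀ {V p} → p ∈ V → ∀ u {d w} → Legal V p (u ++ d ∷ w) →
  Clear V (endpointFrom p u) d × Clear (sitesFrom p u) (endpointFrom p u) d
legal⇒clear p∈V [] (step _ c _) =
  c , λ { k k≥1 (here e) → c k k≥1 (subst (_∈ _) (sym e) p∈V) }
legal⇒clear p∈V (_ ∷ u) (step _ _ l) with c , c′ ← legal⇒clear (here refl) u l =
  (λ k k≥1 m → c k k≥1 (there m)) ,
  λ { k k≥1 (here e)  → c k k≥1 (there (subst (_∈ _) (sym e) p∈V))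
    ; k k≥1 (there m) → c′ k k≥1 m }

snoc : ∀ {P : Site → Set} {V p} → p ∈ V → All P V → All P (V ++ [ p ])
snoc p∈V a = Allₚ.++⁺ a (All.lookup a p∈V ∷ [])

legal⇒extreme : ∀ {V p v} → p ∈ V → Legal V p v → ∀ i →
  Extreme (endpointFrom p (take i v)) (V ++ sitesFrom p (take i v))
legal⇒extreme p∈V l zero = Sum.map (snoc p∈V) (snoc p∈V) (extreme l)
legal⇒extreme p∈V (stop e) (suc i) = Sum.map (snoc p∈V) (snoc p∈V) e
legal⇒extreme {V} p∈V (step _ _ l) (suc i) =
  Sum.map insert insert (legal⇒extreme (here refl) l i)
  where
  insert : ∀ {P : Site → Set} {s S} → All P ((s ∷ V) ++ S) → All P (V ++ _ ∷ S)
  insert (_ ∷ a) with aV , aS ← Allₚ.++⁻ V a = Allₚ.++⁺ aV (All.lookup aV p∈V ∷ aS)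

-- The hypotheses speak of the sites of the whole walk, whose part before p is V.
build : ∀ {V p} v →
  (∀ u d w → v ≡ u ++ d ∷ w → Clear (V ++ sitesFrom p u) (endpointFrom p u) d) →
  (∀ i → i ≤ length v → Extreme (endpointFrom p (take i v)) (V ++ sitesFrom p (take i v))) →
  Legal V p v
build {V} [] _ e = stop (Sum.map (Allₚ.++⁻ˡ V) (Allₚ.++⁻ˡ V) (e 0 z≤n))
build {V} {p} (d ∷ v) c e = step
  (Sum.map (Allₚ.++⁻ˡ V) (Allₚ.++⁻ˡ V) (e 0 z≤n))
  (λ k k≥1 m → c [] d v refl k k≥1 (∈-++⁺ˡ m))
  (build v
    (λ u d′ w eq k k≥1 m → c (d ∷ u) d′ w (cong (d ∷_) eq) k k≥1 (move∈ (start∈ _ u) m))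
    (λ i i≤ → Sum.map (moveAll (start∈ _ (take i v))) (moveAll (start∈ _ (take i v)))
                      (e (suc i) (s≤s i≤))))
  where
  p′ = move 1 d p
  move∈ : ∀ {S s} → p′ ∈ S → s ∈ (p′ ∷ V) ++ S → s ∈ V ++ p ∷ S
  move∈ p′∈ (here refl) = ∈-++⁺ʳ V (there p′∈)
  move∈ p′∈ (there m) with ∈-++⁻ V m
  ... | inj₁ m′ = ∈-++⁺ˡ m′
  ... | inj₂ m′ = ∈-++⁺ʳ V (there m′)
  moveAll : ∀ {P : Site → Set} {S} → p′ ∈ S → All P (V ++ p ∷ S) → All P ((p′ ∷ V) ++ S)
  moveAll p′∈ a = All.tabulate (λ m → All.lookup a (move∈ p′∈ m))

-- Sides of the bounding box through maximal coordinates

hull : List Site → Box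
hull = foldr extend (box 0ℤ 0ℤ 0ℤ 0ℤ)

xmin≤ : ∀ {V s} → s ∈ V → xmin (hull V) ℤ.≤ proj₁ s
xmin≤ (here refl) = ℤₚ.i⊓j≤i _ _
xmin≤ (there m)   = ℤₚ.≤-trans (ℤₚ.i⊓j≤j _ _) (xmin≤ m)

ymin≤ : ∀ {V s} → s ∈ V → ymin (hull V) ℤ.≤ proj₂ s
ymin≤ (here refl) = ℤₚ.i⊓j≤i _ _
ymin≤ (there m)   = ℤₚ.≤-trans (ℤₚ.i⊓j≤j _ _) (ymin≤ m)

≤xmax : ∀ {V s} → s ∈ V → proj₁ s ℤ.≤ xmax (hull V)
≤xmax (here refl) = ℤₚ.i≤i⊔j _ _
≤xmax (there m)   = ℤₚ.≤-trans (≤xmax m) (ℤₚ.i≤j⊔i _ _)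

≤ymax : ∀ {V s} → s ∈ V → proj₂ s ℤ.≤ ymax (hull V)
≤ymax (here refl) = ℤₚ.i≤i⊔j _ _
≤ymax (there m)   = ℤₚ.≤-trans (≤ymax m) (ℤₚ.i≤j⊔i _ _)

xmax≤ : ∀ {V x} → 0ℤ ℤ.≤ x → All (λ s → proj₁ s ℤ.≤ x) V → xmax (hull V) ℤ.≤ x
xmax≤ 0≤ []      = 0≤
xmax≤ 0≤ (h ∷ a) = ℤₚ.⊔-lub h (xmax≤ 0≤ a)

ymax≤ : ∀ {V y} → 0ℤ ℤ.≤ y → All (λ s → proj₂ s ℤ.≤ y) V → ymax (hull V) ℤ.≤ y
ymax≤ 0≤ []      = 0≤
ymax≤ 0≤ (h ∷ a) = ℤₚ.⊔-lub h (ymax≤ 0≤ a)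

-- The fold starts at the origin, so a maximum over `V` bounds the box because `origin ∈ V`; the
-- range conditions along the side follow from `p ∈ V`.
extreme⇔onSide : ∀ {V p} → origin ∈ V → p ∈ V →
  Extreme p V ⇔ (OnNorthSide p (hull V) ⊎ OnEastSide p (hull V))
extreme⇔onSide o∈V p∈V = mk⇔
  (Sum.map
    (λ t → xmin≤ p∈V , ≤xmax p∈V , ℤₚ.≤-antisym (≤ymax p∈V) (ymax≤ (All.lookup t o∈V) t))
    (λ r → ℤₚ.≤-antisym (≤xmax p∈V) (xmax≤ (All.lookup r o∈V) r) , ymin≤ p∈V , ≤ymax p∈V))
  (Sum.map
    (λ (_ , _ , e) → All.tabulate (λ m → subst (_ ℤ.≤_) (sym e) (≤ymax m)))
    (λ (e , _ , _) → All.tabulate (λ m → subst (_ ℤ.≤_) (sym e) (≤xmax m))))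

-- The sites of the walk list the origin again after the initial `[ origin ]`. The repetition is
-- harmless, as only membership in the visited list matters.
legal⇔ : ∀ ω → Legal [ origin ] origin ω ⇔ (Prudent ω × TwoSided ω)
legal⇔ ω = mk⇔
  (λ l → (legal⇒unique (here refl) l ,
          λ { u d w refl → proj₂ (legal⇒clear (here refl) u l) }) ,
         λ i _ → to (onSide i) (Sum.map All.tail All.tail (legal⇒extreme (here refl) l i)))
  (λ ((_ , c) , t) → build ω
    (λ u d w eq k k≥1 m → c u d w eq k k≥1 (drop-origin u m))
    (λ i i≤ → Sum.map (prepend i) (prepend i) (from (onSide i) (t i i≤))))
  where
  onSide : ∀ i → _
  onSide i = extreme⇔onSide {sites (take i ω)} (start∈ origin (take i ω)) (endpoint∈ origin (take i ω))
  drop-origin : ∀ u {s} → s ∈ [ origin ] ++ sites u → s ∈ sites u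
  drop-origin u (here refl) = start∈ origin u
  drop-origin u (there m)   = m
  prepend : ∀ i {P : Site → Set} → All P (sites (take i ω)) → All P ([ origin ] ++ sites (take i ω))
  prepend i a = All.lookup a (start∈ origin (take i ω)) ∷ a

-- Reflection in the diagonal

reflect : Site → Site
reflect (x , y) = y , x

flip : Direction → Direction
flip north = east
flip south = west
flip east  = north
flip west  = south

flip-flip : ∀ d → flip (flip d) ≡ d
flip-flip north = refl
flip-flip south = refl
flip-flip east  = refl
flip-flip west  = refl

mirror : Walk → Walk
mirror = map flip

mirror-mirror : ∀ ω → mirror (mirror ω) ≡ ω
mirror-mirror ω = trans (sym (map-∘ ω)) (trans (map-cong flip-flip ω) (map-id ω))

move-flip : ∀ k d p → move k (flip d) (reflect p) ≡ reflect (move k d p)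
move-flip k north p = refl
move-flip k south p = refl
move-flip k east  p = refl
move-flip k west  p = refl

∈-reflect⁻ : ∀ {s V} → reflect s ∈ map reflect V → s ∈ V
∈-reflect⁻ m with _ , s′∈ , refl ← ∈-map⁻ reflect m = s′∈

extreme-mirror : ∀ {V p} → Extreme p V → Extreme (reflect p) (map reflect V)
extreme-mirror = Sum.swap ∘ Sum.map Allₚ.map⁺ Allₚ.map⁺

legal-mirror : ∀ {V p v} → Legal V p v → Legal (map reflect V) (reflect p) (mirror v)
legal-mirror (stop e) = stop (extreme-mirror e)
legal-mirror {V} {p} (step {d} e c l) = step (extreme-mirror e)
  (λ k k≥1 m → c k k≥1 (∈-reflect⁻ (subst (_∈ map reflect V) (move-flip k d p) m)))
  (subst (λ p′ → Legal (p′ ∷ map reflect V) p′ _) (sym (move-flip 1 d p)) (legal-mirror l))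

endpoint-mirror : ∀ p v → endpointFrom (reflect p) (mirror v) ≡ reflect (endpointFrom p v)
endpoint-mirror p []      = refl
endpoint-mirror p (d ∷ v) =
  trans (cong (λ p′ → endpointFrom p′ (mirror v)) (move-flip 1 d p)) (endpoint-mirror _ v)

polygon⇔ : ∀ ω → TwoSidedPrudentPolygon ω ⇔
  (Legal [ origin ] origin ω × length ω > 1 × Adjacent origin (endpoint ω))
polygon⇔ ω = mk⇔
  (λ ((p , ℓ , a) , t) → from (legal⇔ ω) (p , t) , ℓ , a)
  (λ (l , ℓ , a) → let p , t = to (legal⇔ ω) l in (p , ℓ , a) , t)

polygon-mirror : ∀ {ω} → TwoSidedPrudentPolygon ω → TwoSidedPrudentPolygon (mirror ω)
polygon-mirror {ω} P with l , ℓ , d , e ← to (polygon⇔ ω) P =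
  from (polygon⇔ (mirror ω)) (legal-mirror l , subst (_> 1) (sym (length-map flip ω)) ℓ ,
    flip d , trans (endpoint-mirror origin ω) (trans (cong reflect e) (sym (move-flip 1 d origin))))

-- Classification

-- Columns are numbered from right to left, so that s is the width of a row
-- reaching from column s to the wall R.
col : ℤ → ℕ → ℤ
col R s = R ℤ.- + s

col-east : ∀ R s → col R (suc s) ℤ.+ + 1 ≡ col R s
col-east R s = lemma R (+ s)
  where
  lemma : ∀ R s → R ℤ.- (+ 1 ℤ.+ s) ℤ.+ + 1 ≡ R ℤ.- s
  lemma = solve-∀

col-west : ∀ R s → col R s ℤ.- + 1 ≡ col R (suc s)
col-west R s = lemma R (+ s)
  where
  lemma : ∀ R s → R ℤ.- s ℤ.- + 1 ≡ R ℤ.- (+ 1 ℤ.+ s)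
  lemma = solve-∀

east-step : ∀ R s y → move 1 east (col R (suc s) , y) ≡ (col R s , y)
east-step R s y = cong (_, y) (col-east R s)

west-step : ∀ R s y → move 1 west (col R s , y) ≡ (col R (suc s) , y)
west-step R s y = cong (_, y) (col-west R s)

+suc : ∀ y → + y ℤ.+ + 1 ≡ + suc y
+suc y = cong +_ (ℕₚ.+-comm y 1)

north-step : ∀ x y → move 1 north (x , + y) ≡ (x , + suc y)
north-step x y = cong (x ,_) (+suc y)

x+k-k≡x : ∀ x k → (x ℤ.+ k) ℤ.- k ≡ x
x+k-k≡x = solve-∀

x-k+k≡x : ∀ x k → (x ℤ.- k) ℤ.+ k ≡ x
x-k+k≡x = solve-∀

x<x+k : ∀ x {k} → k ≥ 1 → ¬ x ℤ.+ + k ℤ.≤ x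
x<x+k x {k} k≥1 h with subst₂ ℤ._≤_ (lemma x (+ k)) (ℤₚ.+-inverseʳ x) (ℤₚ.+-monoˡ-≤ (ℤ.- x) h)
  where
  lemma : ∀ x k → x ℤ.+ k ℤ.- x ≡ k
  lemma = solve-∀
... | +≤+ k≤0 = contradiction (ℕₚ.≤-trans k≥1 k≤0) λ ()

x-k<x : ∀ x {k} → k ≥ 1 → ¬ x ℤ.≤ x ℤ.- + k
x-k<x x {k} k≥1 h = x<x+k (x ℤ.- + k) k≥1 (subst (ℤ._≤ x ℤ.- + k) (sym (x-k+k≡x x (+ k))) h)

1≤1 : 1 ≥ 1
1≤1 = s≤s z≤n

-- Only the difference of the two columns matters, and successors cancel by computation. A bar
-- written for the wall x = 1 is therefore definitionally also one for the wall x = 0.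
turn : ℕ → ℕ → Walk
turn s       zero    = replicate s east
turn zero    (suc t) = replicate (suc t) west
turn (suc s) (suc t) = turn s t

turn-refl : ∀ s → turn s s ≡ []
turn-refl zero    = refl
turn-refl (suc s) = turn-refl s

turn-east : ∀ {s t} → t ≤ s → turn (suc s) t ≡ east ∷ turn s t
turn-east z≤n       = refl
turn-east (s≤s t≤s) = turn-east t≤s

turn-west : ∀ {s t} → s < t → turn s t ≡ west ∷ turn (suc s) t
turn-west {zero}  {suc t}       (s≤s _)   = cong (west ∷_) (turn-0 t)
  where
  turn-0 : ∀ t → replicate t west ≡ turn 0 t
  turn-0 zero    = refl
  turn-0 (suc t) = refl
turn-west {suc s} {suc t} (s≤s s<t) = turn-west s<t

-- climb s as y starts in column s at height y, stacks rows of widths suc a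
-- for a in as, and comes down along the wall in column 0.
climb : ℕ → List ℕ → ℕ → Walk
climb s []       y = turn s 0 ++ replicate y south
climb s (a ∷ as) y = turn s (suc a) ++ north ∷ climb (suc a) as (suc y)

-- The default 0 beyond the list treats the final run to the wall as a row of width 0, and gives
-- empty rows above the stack.
width : List ℕ → ℕ → ℕ
width []       _       = 0
width (a ∷ as) zero    = suc a
width (a ∷ as) (suc i) = width as i

climb-east : ∀ {s} as {y} → width as 0 ≤ s → climb (suc s) as y ≡ east ∷ climb s as y
climb-east []       h = refl
climb-east (a ∷ as) h = cong (_++ _) (turn-east h)

climb-west : ∀ {s} as {y} → s < width as 0 → climb s as y ≡ west ∷ climb (suc s) as y
climb-west (a ∷ as) h = cong (_++ _) (turn-west h)

climb-north : ∀ s as y → climb (suc s) (s ∷ as) y ≡ north ∷ climb (suc s) as (suc y)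
climb-north s as y = cong (_++ north ∷ climb (suc s) as (suc y)) (turn-refl s)

-- Ways back to the origin that are ruled out

end-extreme : ∀ {V p v} → Legal V p v → Extreme (endpointFrom p v) V
end-extreme (stop e)     = e
end-extreme (step _ _ l) = Sum.map All.tail All.tail (end-extreme l)

end-revisit : ∀ {V p v} → Legal V p v → endpointFrom p v ∈ V → endpointFrom p v ≡ p
end-revisit {p = p} {v} l m = revisit l m (endpoint∈ p v)

-- The closing site could only be (0 , 1), and then on top of the box, hence
-- the site (0 , suc m) is that very site and has already been visited.
overshoot : ∀ {V p v s m} → Legal V p v → s ∈ V → + 2 ℤ.≤ proj₁ s →
  (0ℤ , + suc m) ∈ V → p ≢ (0ℤ , 1ℤ) → ¬ Adjacent origin (endpointFrom p v)
overshoot {V} {p} l s∈ 2≤ t∈ p≢ (d , e) =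
  go d (subst (λ e → Extreme e V × (e ∈ V → e ≡ p)) e (end-extreme l , end-revisit l))
  where
  go : ∀ d → ¬ (Extreme (move 1 d origin) V × (move 1 d origin ∈ V → move 1 d origin ≡ p))
  go north (inj₁ t , rv) with +≤+ (s≤s z≤n) ← All.lookup t t∈ = p≢ (sym (rv t∈))
  go north (inj₂ r , rv) with +≤+ () ← ℤₚ.≤-trans 2≤ (All.lookup r s∈)
  go south (inj₁ t , rv) with () ← All.lookup t t∈
  go south (inj₂ r , rv) with +≤+ () ← ℤₚ.≤-trans 2≤ (All.lookup r s∈)
  go east  (inj₁ t , rv) with +≤+ () ← All.lookup t t∈
  go east  (inj₂ r , rv) with +≤+ (s≤s ()) ← ℤₚ.≤-trans 2≤ (All.lookup r s∈)
  go west  (inj₁ t , rv) with +≤+ () ← All.lookup t t∈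
  go west  (inj₂ r , rv) with () ← ℤₚ.≤-trans 2≤ (All.lookup r s∈)

-- Climbing above the height at which column 0 was reached rules out returning.
overclimb : ∀ {V p v x m k} → Legal V p v → p ≡ (x , + (suc m + suc k)) → x ℤ.≤ 1ℤ → p ∈ V →
  (0ℤ , + suc m) ∈ V → (1ℤ , + suc m) ∈ V → ¬ Adjacent origin (endpointFrom p v)
overclimb {m = m} {k} (stop _) refl x≤1 p∈ 0∈ 1∈ (d , e) = go d (cong proj₂ e)
  where
  go : ∀ d → + (suc m + suc k) ≢ proj₂ (move 1 d origin)
  go north e rewrite ℕₚ.+-suc m k with () ← e
  go south ()
  go east ()
  go west ()
overclimb {x = x} {m} {k} (step {north} _ _ l) refl x≤1 p∈ 0∈ 1∈ =
  overclimb l (trans (north-step x (suc m + suc k)) (cong (λ y → x , + y) (sym (ℕₚ.+-suc (suc m) (suc k)))))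
    x≤1 (here refl) (there 0∈) (there 1∈)
overclimb {V} {x = x} {m} {k} (step {south} _ c l) refl x≤1 p∈ 0∈ 1∈ with x ℤ.≟ 1ℤ
... | yes refl = contradiction
        (subst (_∈ V) (cong (1ℤ ,_) (sym (x+k-k≡x (+ suc m) (+ suc k)))) 1∈)
        (c (suc k) (s≤s z≤n))
... | no x≢1 with extreme l
...   | inj₁ (_ ∷ t) = contradiction (All.lookup t p∈) (x-k<x _ 1≤1)
...   | inj₂ (_ ∷ r) = contradiction (ℤₚ.≤-antisym x≤1 (All.lookup r 1∈)) x≢1
overclimb (step {west} _ _ l) refl x≤1 p∈ 0∈ 1∈ =
  overclimb l refl (ℤₚ.i≤j⇒i-k≤j (+ 1) x≤1) (here refl) (there 0∈) (there 1∈)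
overclimb {x = x} (step {east} _ _ l) refl x≤1 p∈ 0∈ 1∈ with x ℤ.+ + 1 ℤ.≤? 1ℤ
... | yes x+1≤1 = overclimb l refl x+1≤1 (here refl) (there 0∈) (there 1∈)
... | no  x+1≰1 = overshoot l (here refl) 2≤ (there 0∈)
  (λ e → contradiction (ℤₚ.≤-trans 2≤ (ℤₚ.≤-reflexive (cong proj₁ e))) λ { (+≤+ ()) })
  where
  2≤ : + 2 ℤ.≤ x ℤ.+ + 1
  2≤ = ℤₚ.i<j⇒suc[i]≤j (ℤₚ.≰⇒> x+1≰1)

-- The site above blocks north, a west step ends on neither side, and an east step overshoots. The
-- height is an arbitrary integer, since nothing so far stops a walk from passing below 0; the
-- closing site (1 , 0) then shows, back along the descent, that it is a natural number.
descend : ∀ {V v y m} → Legal V (1ℤ , y) v → (1ℤ , y) ∈ V → (1ℤ , y ℤ.+ + 1) ∈ V →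
  (0ℤ , + suc m) ∈ V → Adjacent origin (endpointFrom (1ℤ , y) v) →
  ∃[ k ] y ≡ + k × v ≡ replicate k south
descend (stop _) _ _ _ (east , refl) = 0 , refl , refl
descend {V} {y = y} (step {south} _ c l) p∈ up∈ 0∈ adj
  with k , e , refl ← descend l (here refl)
         (there (subst (λ z → (1ℤ , z) ∈ V) (sym (x-k+k≡x y (+ 1))) p∈)) (there 0∈) adj
  = suc k , trans (sym (x-k+k≡x y (+ 1))) (trans (cong (ℤ._+ + 1) e) (+suc k)) , refl
descend (step {north} _ c l) p∈ up∈ 0∈ adj = contradiction up∈ (c 1 1≤1)
descend (step {east} _ _ l) p∈ up∈ 0∈ adj =
  contradiction adj (overshoot l (here refl) (+≤+ (s≤s (s≤s z≤n))) (there 0∈) λ ())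
descend {y = y} (step {west} _ _ l) p∈ up∈ 0∈ adj with extreme l
... | inj₁ (_ ∷ t) = contradiction (All.lookup t up∈) (x<x+k y 1≤1)
... | inj₂ (_ ∷ r) with +≤+ () ← All.lookup r up∈

-- On reaching the wall, north overclimbs, east overshoots, and west is the visited site (0 , suc
-- m).
summit : ∀ {V p v m} → Legal V p v → p ≡ (1ℤ , + suc m) → p ∈ V → (0ℤ , + suc m) ∈ V →
  Adjacent origin (endpointFrom p v) → v ≡ replicate (suc m) south
summit (stop _) refl p∈ 0∈ (north , ())
summit (stop _) refl p∈ 0∈ (south , ())
summit (stop _) refl p∈ 0∈ (east , ())
summit (stop _) refl p∈ 0∈ (west , ())
summit {m = m} (step {north} _ _ l) refl p∈ 0∈ adj = contradiction adj
  (overclimb {m = m} {0} l refl ℤₚ.≤-refl (here refl) (there 0∈) (there p∈))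
summit {V} {m = m} (step {south} _ _ l) refl p∈ 0∈ adj
  with k , e , refl ← descend l (here refl)
         (there (subst (λ z → (1ℤ , z) ∈ V) (sym (x-k+k≡x (+ suc m) (+ 1))) p∈)) (there 0∈) adj
  with refl ← ℤₚ.+-injective e = refl
summit (step {east} _ _ l) refl p∈ 0∈ adj =
  contradiction adj (overshoot l (here refl) (+≤+ (s≤s (s≤s z≤n))) (there 0∈) λ ())
summit (step {west} _ c _) refl p∈ 0∈ adj = contradiction 0∈ (c 1 1≤1)

-- In the column x = 0 the origin is straight below, against prudence. Further left the new site has
-- `p` above it and the origin to its right.
no-south : ∀ {V v} s y → s ≥ 1 ⊎ y ≥ 1 → let p = (col 1ℤ (suc s) , + y) in
  p ∈ V → origin ∈ V → Clear V p south → ¬ Legal (move 1 south p ∷ V) (move 1 south p) v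
no-south zero    y (inj₁ ())
no-south {V} zero y (inj₂ y≥1) p∈ o∈ c l =
  contradiction (subst (λ z → (0ℤ , z) ∈ V) (sym (ℤₚ.+-inverseʳ (+ y))) o∈) (c y y≥1)
no-south (suc s) y _ p∈ o∈ c l with extreme l
... | inj₁ (_ ∷ t) = contradiction (All.lookup t p∈) (x-k<x (+ y) 1≤1)
... | inj₂ (_ ∷ r) with () ← All.lookup r o∈

closing : ∀ {s y} → Adjacent origin (col 1ℤ (suc s) , + y) → (s ≡ 0 × y ≡ 1) ⊎ (s ≡ 1 × y ≡ 0)
closing {zero}        (north , refl) = inj₁ (refl , refl)
closing {zero}        (south , ())
closing {zero}        (east , ())
closing {zero}        (west , ())
closing {suc zero}    (west , refl) = inj₂ (refl , refl)
closing {suc zero}    (north , ())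
closing {suc zero}    (south , ())
closing {suc zero}    (east , ())
closing {suc (suc s)} (north , ())
closing {suc (suc s)} (south , ())
closing {suc (suc s)} (east , ())
closing {suc (suc s)} (west , ())

-- Before the wall is crossed, the state of the walk is its last direction, here north; after a
-- horizontal step the reverse step is blocked. The alternative with `y ≡ 0` is the second half of a
-- bar, closing at (0 , 1).
rising : ∀ {V p v s y} → Legal V p v → p ≡ (col 1ℤ (suc s) , + suc y) → p ∈ V → origin ∈ V →
  Adjacent origin (endpointFrom p v) →
  (∃[ as ] v ≡ climb (suc s) as (suc y)) ⊎ (y ≡ 0 × v ≡ turn (suc s) 1)

-- The width bound records that a row entered moving east ends no further left than the current
-- column; `climb-east` needs it to absorb the preceding east step.
eastward : ∀ {V p v s y} → Legal V p v → p ≡ (col 1ℤ (suc s) , + suc y) → p ∈ V → origin ∈ V →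
  move 1 west p ∈ V → Adjacent origin (endpointFrom p v) →
  (∃[ as ] width as 0 ≤ suc s × v ≡ climb (suc s) as (suc y)) ⊎ (y ≡ 0 × v ≡ turn (suc s) 1)

eastward-step : ∀ {V p v s y} → p ≡ (col 1ℤ (suc s) , + suc y) → p ∈ V → origin ∈ V →
  Legal (move 1 east p ∷ V) (move 1 east p) v → Adjacent origin (endpointFrom (move 1 east p) v) →
  (∃[ as ] width as 0 ≤ s × east ∷ v ≡ climb (suc s) as (suc y)) ⊎
  (y ≡ 0 × east ∷ v ≡ turn (suc s) 1)

-- The height may be 0 here, as the bottom row can be laid by initial west steps. The negated
-- hypothesis excludes the single step west, which already ends next to the origin. In the second
-- alternative `c` is the length of the bar.
westward : ∀ {V p v s y} → Legal V p v → p ≡ (col 1ℤ (suc (suc s)) , + y) → p ∈ V → origin ∈ V →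
  move 1 east p ∈ V → Adjacent origin (endpointFrom p v) → ¬ (y ≡ 0 × s ≡ 0 × v ≡ []) →
  (∃[ as ] suc s < width as 0 × v ≡ climb (suc (suc s)) as y) ⊎
  (y ≡ 0 × ∃[ c ] suc s ≤ c × v ≡ turn (suc (suc s)) (suc c) ++ north ∷ turn (suc c) 1)

rising {s = s} {y} (stop _) refl p∈ o∈ adj with closing {s} {suc y} adj
... | inj₁ (refl , refl) = inj₂ (refl , refl)
... | inj₂ (_ , ())
rising {s = s} {y} (step {north} _ _ l) refl p∈ o∈ adj
  with rising {s = s} {suc y} l (north-step _ (suc y)) (here refl) (there o∈) adj
-- The bar alternative would say `suc y ≡ 0`: above height 1 the site (0 , 1) is out of reach.
... | inj₁ (as , refl) = inj₁ (s ∷ as , sym (climb-north s as (suc y)))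
rising {s = s} {y} (step {south} _ c l) refl p∈ o∈ adj =
  contradiction l (no-south s (suc y) (inj₂ (s≤s z≤n)) p∈ o∈ c)
rising {s = s} {y} (step {east} _ _ l) refl p∈ o∈ adj =
  Sum.map₁ (λ (as , _ , e) → as , e) (eastward-step {s = s} {y} refl p∈ o∈ l adj)
rising {V} {s = s} {y} (step {west} _ _ l) refl p∈ o∈ adj
  with westward {s = s} {suc y} l (west-step 1ℤ (suc s) _) (here refl) (there o∈)
         (there (subst (λ x → (x , + suc y) ∈ V) (sym (x-k+k≡x _ (+ 1))) p∈)) adj (λ ())
... | inj₁ (as , h , refl) = inj₁ (as , sym (climb-west as h))

eastward {s = s} {y} (stop _) refl p∈ o∈ w∈ adj with closing {s} {suc y} adj
... | inj₁ (refl , refl) = inj₂ (refl , refl)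
... | inj₂ (_ , ())
eastward {s = s} {y} (step {north} _ _ l) refl p∈ o∈ w∈ adj
  with rising {s = s} {suc y} l (north-step _ (suc y)) (here refl) (there o∈) adj
... | inj₁ (as , refl) = inj₁ (s ∷ as , ℕₚ.≤-refl , sym (climb-north s as (suc y)))
eastward {s = s} {y} (step {south} _ c l) refl p∈ o∈ w∈ adj =
  contradiction l (no-south s (suc y) (inj₂ (s≤s z≤n)) p∈ o∈ c)
eastward {s = s} {y} (step {east} _ _ l) refl p∈ o∈ w∈ adj =
  Sum.map₁ (λ (as , h , e) → as , ℕₚ.m≤n⇒m≤1+n h , e) (eastward-step {s = s} {y} refl p∈ o∈ l adj)
eastward (step {west} _ c _) refl p∈ o∈ w∈ adj = contradiction w∈ (c 1 1≤1)

eastward-step {s = zero} refl p∈ o∈ l adj =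
  inj₁ ([] , z≤n , cong (east ∷_) (summit l refl (here refl) (there p∈) adj))
eastward-step {V} {s = suc s} {y} refl p∈ o∈ l adj
  with eastward {s = s} {y} l (east-step 1ℤ (suc s) _) (here refl) (there o∈)
         (there (subst (λ x → (x , + suc y) ∈ V) (sym (x+k-k≡x _ (+ 1))) p∈)) adj
... | inj₁ (as , h , refl) = inj₁ (as , h , sym (climb-east as h))
... | inj₂ (refl , refl)   = inj₂ (refl , refl)

westward {s = s} {y} (stop _) refl p∈ o∈ e∈ adj nontrivial with closing {suc s} {y} adj
... | inj₁ (() , _)
... | inj₂ (refl , refl) = contradiction (refl , refl , refl) nontrivial
westward {s = s} {y} (step {north} _ _ l) refl p∈ o∈ e∈ adj _
  with rising {s = suc s} {y} l (north-step _ y) (here refl) (there o∈) adj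
... | inj₁ (as , refl)   = inj₁ (suc s ∷ as , ℕₚ.≤-refl , sym (climb-north (suc s) as y))
... | inj₂ (refl , refl) = inj₂ (refl , suc s , ℕₚ.≤-refl ,
    cong (_++ north ∷ turn (suc (suc s)) 1) (sym (turn-refl s)))
westward {s = s} {y} (step {south} _ c l) refl p∈ o∈ e∈ adj _ =
  contradiction l (no-south (suc s) y (inj₁ (s≤s z≤n)) p∈ o∈ c)
westward (step {east} _ c _) refl p∈ o∈ e∈ adj _ = contradiction e∈ (c 1 1≤1)
westward {V} {s = s} {y} (step {west} _ _ l) refl p∈ o∈ e∈ adj _
  with westward {s = suc s} {y} l (west-step 1ℤ (suc (suc s)) _) (here refl) (there o∈)
         (there (subst (λ x → (x , + y) ∈ V) (sym (x-k+k≡x _ (+ 1))) p∈)) adj (λ ())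
... | inj₁ (as , h , refl)       = inj₁ (as , ℕₚ.<⇒≤ h , sym (climb-west as h))
... | inj₂ (refl , c , h , refl) =
  inj₂ (refl , c , ℕₚ.<⇒≤ h , cong (_++ _) (sym (turn-west (s≤s h))))

pile : ℕ × List ℕ → Walk
pile (a , as) = climb 1 (a ∷ as) 0

bar : ℕ → Walk
bar n = turn 1 (suc n) ++ north ∷ turn (suc n) 1

-- The index is `suc n` because `bar 0` is the single step north, which is too short to be a
-- polygon.
Upper : Walk → Set
Upper ω = (∃[ as ] ω ≡ pile as) ⊎ (∃[ n ] ω ≡ bar (suc n))

classify-upper : ∀ d v → d ≡ north ⊎ d ≡ west → Legal [ origin ] origin (d ∷ v) →
  length (d ∷ v) > 1 → Adjacent origin (endpoint (d ∷ v)) → Upper (d ∷ v)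
classify-upper _ v (inj₁ refl) (step _ _ l) ℓ>1 adj
  with rising {s = 0} {0} l refl (here refl) (there (here refl)) adj
... | inj₁ (as , refl) = inj₁ ((0 , as) , refl)
... | inj₂ (_ , refl)  with s≤s () ← ℓ>1
classify-upper _ v (inj₂ refl) (step _ _ l) ℓ>1 adj
  with westward {s = 0} {0} l refl (here refl) (there (here refl)) (there (here refl)) adj
         (λ { (_ , _ , refl) → contradiction (s≤s⁻¹ ℓ>1) λ () })
... | inj₁ (a ∷ as , h , refl)          = inj₁ ((a , as) , sym (climb-west (a ∷ as) h))
... | inj₂ (_ , suc n , s≤s h , refl) =
  inj₂ (n , cong (_++ north ∷ turn (suc (suc n)) 1) (sym (turn-west {1} {suc (suc n)} (s≤s (s≤s h)))))

classify : ∀ ω → TwoSidedPrudentPolygon ω → Upper ω ⊎ Upper (mirror ω)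
classify ω P with to (polygon⇔ ω) P | to (polygon⇔ (mirror ω)) (polygon-mirror P)
classify []          P | _ , () , _ | _
classify (north ∷ v) P | l , ℓ , a | _ = inj₁ (classify-upper north v (inj₁ refl) l ℓ a)
classify (west ∷ v)  P | l , ℓ , a | _ = inj₁ (classify-upper west v (inj₂ refl) l ℓ a)
classify (east ∷ v)  P | _ | l , ℓ , a = inj₂ (classify-upper north (mirror v) (inj₁ refl) l ℓ a)
classify (south ∷ v) P | _ | l , ℓ , a = inj₂ (classify-upper west (mirror v) (inj₂ refl) l ℓ a)

-- Piles and bars are legal

-- `turn` recurses on both columns at once and not along the walk; `EastRun` and `WestRun` restore
-- induction step by step.
data EastRun (t : ℕ) : ℕ → Walk → Set where
  done : EastRun t t []
  step : ∀ {s u} → t ≤ s → EastRun t s u → EastRun t (suc s) (east ∷ u)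

data WestRun (t : ℕ) : ℕ → Walk → Set where
  done : WestRun t t []
  step : ∀ {s u} → s < t → WestRun t (suc s) u → WestRun t s (west ∷ u)

eastRun : ∀ {s t} → t ≤′ s → EastRun t s (turn s t)
eastRun {t = t} (≤′-reflexive refl) = subst (EastRun t t) (sym (turn-refl t)) done
eastRun {t = t} (≤′-step t≤s) =
  subst (EastRun t _) (sym (turn-east (ℕₚ.≤′⇒≤ t≤s))) (step (ℕₚ.≤′⇒≤ t≤s) (eastRun t≤s))

westRun : ∀ {s t} → s ≤‴ t → WestRun t s (turn s t)
westRun {t = t} (≤‴-reflexive refl) = subst (WestRun t t) (sym (turn-refl t)) done
westRun {t = t} (≤‴-step s<t) =
  subst (WestRun t _) (sym (turn-west (ℕₚ.≤‴⇒≤ s<t))) (step (ℕₚ.≤‴⇒≤ s<t) (westRun s<t))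

turn-run : ∀ s t → EastRun t s (turn s t) ⊎ WestRun t s (turn s t)
turn-run s t = Sum.map (eastRun ∘ ℕₚ.≤⇒≤′) (westRun ∘ ℕₚ.≤⇒≤‴) (ℕₚ.≤-total t s)

AtMost : ℤ → Site → Set
AtMost y (x′ , y′) = x′ ℤ.≤ 0ℤ × y′ ℤ.≤ y

-- The invariant along a row: the row is the top one, and its visited sites all lie behind the
-- moving walk, so both its direction and north are clear.
RowBehindWest RowBehindEast : Site → Site → Set
RowBehindWest (x , y) (x′ , y′) = x′ ℤ.≤ 0ℤ × (y′ ℤ.< y ⊎ (y′ ≡ y × x′ ℤ.≤ x))
RowBehindEast (x , y) (x′ , y′) = x′ ℤ.≤ 0ℤ × (y′ ℤ.< y ⊎ (y′ ≡ y × x ℤ.≤ x′))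

col≤0 : ∀ s → col 1ℤ (suc s) ℤ.≤ 0ℤ
col≤0 zero    = ℤₚ.≤-refl
col≤0 (suc s) = -≤+

x≤x+1 : ∀ x → x ℤ.≤ x ℤ.+ + 1
x≤x+1 x = ℤₚ.i≤i+j x (+ 1)

x-1≤x : ∀ x → x ℤ.- + 1 ℤ.≤ x
x-1≤x x = ℤₚ.i≤j⇒i-k≤j (+ 1) ℤₚ.≤-refl

x<x+1 : ∀ x → x ℤ.< x ℤ.+ + 1
x<x+1 x = ℤₚ.≰⇒> (x<x+k x 1≤1)

atMost : ∀ {y x′ y′ : ℤ} {P : Set} →
  x′ ℤ.≤ 0ℤ × (y′ ℤ.< y ⊎ (y′ ≡ y × P)) → AtMost y (x′ , y′)
atMost (x≤0 , inj₁ y′<y)       = x≤0 , ℤₚ.<⇒≤ y′<y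
atMost (x≤0 , inj₂ (refl , _)) = x≤0 , ℤₚ.≤-refl

-- The rest `v` enters as a continuation valid for every visited list with the invariant, so the
-- sites added by the run need not be named.
legal-east : ∀ {V s t u v p y} → EastRun (suc t) (suc s) u → p ≡ (col 1ℤ (suc s) , y) →
  All (RowBehindWest p) V →
  (∀ {V} → All (RowBehindWest (col 1ℤ (suc t) , y)) V → Legal V (col 1ℤ (suc t) , y) v) →
  Legal V p (u ++ v)
legal-east done refl a k = k a
legal-east {s = suc s} {y = y} (step _ r) refl a k = step
  (inj₁ (All.map (proj₂ ∘ atMost) a))
  (λ k k≥1 m → clear k≥1 (All.lookup a m))
  (legal-east r (east-step 1ℤ (suc s) y)
    ((ℤₚ.≤-trans (ℤₚ.≤-reflexive (col-east 1ℤ (suc s))) (col≤0 s) , inj₂ (refl , ℤₚ.≤-refl))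
      ∷ All.map (map₂ (Sum.map₂ (map₂ (λ h → ℤₚ.≤-trans h (x≤x+1 _))))) a) k)
  where
  clear : ∀ {x k} → k ≥ 1 → ¬ RowBehindWest (x , y) (x ℤ.+ + k , y)
  clear k≥1 (_ , inj₁ y<y)     = ℤₚ.<-irrefl refl y<y
  clear k≥1 (_ , inj₂ (_ , h)) = x<x+k _ k≥1 h

legal-west : ∀ {V s t u v p y} → WestRun (suc t) (suc s) u → p ≡ (col 1ℤ (suc s) , y) →
  All (RowBehindEast p) V →
  (∀ {V} → All (RowBehindEast (col 1ℤ (suc t) , y)) V → Legal V (col 1ℤ (suc t) , y) v) →
  Legal V p (u ++ v)
legal-west done refl a k = k a
legal-west {s = s} {y = y} (step _ r) refl a k = step
  (inj₁ (All.map (proj₂ ∘ atMost) a))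
  (λ k k≥1 m → clear k≥1 (All.lookup a m))
  (legal-west r (west-step 1ℤ (suc s) y)
    ((ℤₚ.≤-trans (ℤₚ.≤-reflexive (col-west 1ℤ (suc s))) (col≤0 (suc s)) , inj₂ (refl , ℤₚ.≤-refl))
      ∷ All.map (map₂ (Sum.map₂ (map₂ (ℤₚ.≤-trans (x-1≤x _))))) a) k)
  where
  clear : ∀ {x k} → k ≥ 1 → ¬ RowBehindEast (x , y) (x ℤ.- + k , y)
  clear k≥1 (_ , inj₁ y<y)     = ℤₚ.<-irrefl refl y<y
  clear k≥1 (_ , inj₂ (_ , h)) = x-k<x _ k≥1 h

Entering : Site → Site → Set
Entering p s = proj₁ s ℤ.≤ 0ℤ × (proj₂ s ℤ.< proj₂ p ⊎ s ≡ p)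

entering-west : ∀ {p s} → Entering p s → RowBehindWest p s
entering-west = map₂ (Sum.map₂ λ { refl → refl , ℤₚ.≤-refl })

entering-east : ∀ {p s} → Entering p s → RowBehindEast p s
entering-east = map₂ (Sum.map₂ λ { refl → refl , ℤₚ.≤-refl })

legal-row : ∀ {V v} s t y → let p = (col 1ℤ (suc t) , + suc y) in
  All (Entering (col 1ℤ (suc s) , + y)) V →
  (∀ {V} → All (Entering p) (p ∷ V) → Legal (p ∷ V) p v) →
  Legal V (col 1ℤ (suc s) , + y) (turn (suc s) (suc t) ++ north ∷ v)
legal-row {v = v} s t y a k = [ (λ r → legal-east r refl (All.map entering-west a) (rise ∘ All.map atMost))
  , (λ r → legal-west r refl (All.map entering-east a) (rise ∘ All.map atMost)) ]′
  (turn-run (suc s) (suc t))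
  where
  p′ = (col 1ℤ (suc t) , + suc y)
  rise : ∀ {V} → All (AtMost (+ y)) V → Legal V (col 1ℤ (suc t) , + y) (north ∷ v)
  rise {V} a = step (inj₁ (All.map proj₂ a))
    (λ k k≥1 m → x<x+k (+ y) k≥1 (proj₂ (All.lookup a m)))
    (subst (λ p → Legal (p ∷ V) p v) (sym (north-step _ y))
      (k ((col≤0 t , inj₂ refl) ∷
          All.map (map₂ (λ h → inj₁ (ℤₚ.≤-<-trans h (subst (+ y ℤ.<_) (+suc y) (x<x+1 (+ y)))))) a)))

RightOrAbove : Site → Site → Set
RightOrAbove (x , y) (x′ , y′) = x′ ℤ.< x ⊎ (x′ ≡ x × y ℤ.≤ y′)

legal-south : ∀ {V p} k → All (RightOrAbove p) V → Legal V p (replicate k south)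
legal-south {V} {x , y} k a = go k
  where
  right : Right (x , y) V
  right = All.map [ ℤₚ.<⇒≤ , (λ { (refl , _) → ℤₚ.≤-refl }) ]′ a
  clear : ∀ {k} → k ≥ 1 → ¬ RightOrAbove (x , y) (x , y ℤ.- + k)
  clear k≥1 (inj₁ x<x)     = ℤₚ.<-irrefl refl x<x
  clear k≥1 (inj₂ (_ , h)) = x-k<x y k≥1 h
  go : ∀ k → Legal V (x , y) (replicate k south)
  go zero    = stop (inj₂ right)
  go (suc k) = step (inj₂ right) (λ k k≥1 m → clear k≥1 (All.lookup a m))
    (legal-south k (inj₂ (refl , ℤₚ.≤-refl)
      ∷ All.map (Sum.map₂ (map₂ (ℤₚ.≤-trans (x-1≤x y)))) a))

replicate-∷ : ∀ {A : Set} n (x : A) xs → replicate n x ++ x ∷ xs ≡ replicate (suc n) x ++ xs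
replicate-∷ zero    x xs = refl
replicate-∷ (suc n) x xs = cong (x ∷_) (replicate-∷ n x xs)

legal-climb : ∀ {V} s as y → All (Entering (col 1ℤ (suc s) , + y)) V →
  Legal V (col 1ℤ (suc s) , + y) (climb (suc s) as y)
legal-climb s (a ∷ as) y i = legal-row s a y i (legal-climb a as (suc y))
-- The last east step is split off: it crosses to x = 1, where the invariant x ≤ 0 of the row ends
-- and `RightOrAbove` takes over.
legal-climb s [] y i = subst (Legal _ _) (replicate-∷ s east (replicate y south))
  (legal-east {t = 0} (eastRun (ℕₚ.≤⇒≤′ (s≤s z≤n))) refl (All.map entering-west i) fall)
  where
  fall : ∀ {V} → All (RowBehindWest (0ℤ , + y)) V → Legal V (0ℤ , + y) (east ∷ replicate y south)
  fall a = step (inj₁ (All.map (proj₂ ∘ atMost) a))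
    (λ k k≥1 m → contradiction (proj₁ (All.lookup a m)) (x<x+k 0ℤ k≥1))
    (legal-south y (inj₂ (refl , ℤₚ.≤-refl)
      ∷ All.map (λ (x≤0 , _) → inj₁ (ℤₚ.≤-<-trans x≤0 (+<+ (s≤s z≤n)))) a))

entering-origin : All (Entering origin) [ origin ]
entering-origin = (ℤₚ.≤-refl , inj₂ refl) ∷ []

legal-pile : ∀ as → Legal [ origin ] origin (pile as)
legal-pile (a , as) = legal-climb 0 (a ∷ as) 0 entering-origin

legal-bar : ∀ n → Legal [ origin ] origin (bar n)
legal-bar n = legal-row 0 n 0 entering-origin λ i →
  subst (Legal _ _) (++-identityʳ (turn (suc n) 1))
    (legal-east {t = 0} (eastRun (ℕₚ.≤⇒≤′ (s≤s z≤n))) refl (All.map entering-west i)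
      (λ a → stop (inj₁ (All.map (proj₂ ∘ atMost) a))))

length-++-∷ : ∀ (u : Walk) d w → length w < length (u ++ d ∷ w)
length-++-∷ []      d w = ℕₚ.≤-refl
length-++-∷ (_ ∷ u) d w = ℕₚ.m≤n⇒m≤1+n (length-++-∷ u d w)

climb-nonempty : ∀ s as y → 0 < length (climb (suc s) as y)
climb-nonempty s []       y = s≤s z≤n
climb-nonempty s (a ∷ as) y = ℕₚ.≤-<-trans z≤n (length-++-∷ (turn s a) north _)

endpoint-++ : ∀ p u v → endpointFrom p (u ++ v) ≡ endpointFrom (endpointFrom p u) v
endpoint-++ p []      v = refl
endpoint-++ p (d ∷ u) v = endpoint-++ (move 1 d p) u v

endpoint-turn : ∀ R s t y → endpointFrom (col R s , y) (turn s t) ≡ (col R t , y)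
endpoint-turn R s t y = [ (λ r → eastward-end r refl) , (λ r → westward-end r refl) ]′ (turn-run s t)
  where
  eastward-end : ∀ {s u p} → EastRun t s u → p ≡ (col R s , y) → endpointFrom p u ≡ (col R t , y)
  eastward-end done e = e
  eastward-end {suc s} (step _ r) refl = eastward-end r (east-step R s y)
  westward-end : ∀ {s u p} → WestRun t s u → p ≡ (col R s , y) → endpointFrom p u ≡ (col R t , y)
  westward-end done e = e
  westward-end {s} (step _ r) refl = westward-end r (west-step R s y)

endpoint-row : ∀ R s t y v →
  endpointFrom (col R s , + y) (turn s t ++ north ∷ v) ≡ endpointFrom (col R t , + suc y) v
endpoint-row R s t y v = trans (endpoint-++ (col R s , + y) (turn s t) (north ∷ v))
  (cong (λ p → endpointFrom p v)
    (trans (cong (move 1 north) (endpoint-turn R s t (+ y))) (north-step (col R t) y)))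

endpoint-south : ∀ x k → endpointFrom (x , + k) (replicate k south) ≡ (x , 0ℤ)
endpoint-south x zero    = refl
endpoint-south x (suc k) = endpoint-south x k

endpoint-climb : ∀ s as y → endpointFrom (col 1ℤ s , + y) (climb s as y) ≡ (1ℤ , 0ℤ)
endpoint-climb s [] y = trans (endpoint-++ (col 1ℤ s , + y) (turn s 0) (replicate y south))
  (trans (cong (λ p → endpointFrom p (replicate y south)) (endpoint-turn 1ℤ s 0 (+ y)))
         (endpoint-south 1ℤ y))
endpoint-climb s (a ∷ as) y =
  trans (endpoint-row 1ℤ s (suc a) y (climb (suc a) as (suc y))) (endpoint-climb (suc a) as (suc y))

endpoint-pile : ∀ as → endpoint (pile as) ≡ (1ℤ , 0ℤ)
endpoint-pile (a , as) = endpoint-climb 1 (a ∷ as) 0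

endpoint-bar : ∀ n → endpoint (bar n) ≡ (0ℤ , 1ℤ)
endpoint-bar n = trans (endpoint-row 1ℤ 1 (suc n) 0 (turn (suc n) 1)) (endpoint-turn 1ℤ (suc n) 1 1ℤ)

polygon-pile : ∀ as → TwoSidedPrudentPolygon (pile as)
polygon-pile (a , as) = from (polygon⇔ (pile (a , as)))
  (legal-pile (a , as) ,
   ℕₚ.≤-<-trans (climb-nonempty a as 1) (length-++-∷ (turn 0 a) north _) ,
   east , endpoint-pile (a , as))

polygon-bar : ∀ n → TwoSidedPrudentPolygon (bar (suc n))
polygon-bar n = from (polygon⇔ (bar (suc n)))
  (legal-bar (suc n) , ℕₚ.≤-<-trans (s≤s z≤n) (length-++-∷ (turn 0 (suc n)) north (turn (suc (suc n)) 1)) ,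
   north , endpoint-bar (suc n))

-- The enclosed cells

-- The j-th row of the outlined region extends over w j cells to the left of
-- column 0, so the level at height j separates the rows below w j and w j.
below : (ℕ → ℕ) → ℕ → ℕ
below w zero    = 0
below w (suc j) = w j

Differ : ℕ → ℕ → ℕ → Set
Differ t m n = (t < m × n ≤ t) ⊎ (t < n × m ≤ t)

upright tread : ℤ → ℕ → ℕ → Edge
upright R s j = (col R s , + j) , (col R s , + suc j)
tread   R t j = (col R (suc t) , + j) , (col R t , + j)

data Allowed (R : ℤ) (w : ℕ → ℕ) : Edge → Set where
  level : ∀ {x x′ y} → Allowed R w ((x , y) , (x′ , y))
  up    : ∀ {s j} → s ≡ 0 ⊎ s ≡ w j → Allowed R w (upright R s j)
  down  : ∀ {s j} → s ≡ 0 ⊎ s ≡ w j → Allowed R w (swap (upright R s j))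

-- What is needed of the curve for it to enclose exactly the cells of the rows:
-- every side of the region is on the curve, so a path cannot leave it, and
-- outside cells escape horizontally because few vertical edges are allowed.
record Outline (ω : Walk) (R : ℤ) (w : ℕ → ℕ) : Set where
  field
    allowed : All (Allowed R w) (edges ω)
    right   : ∀ j → 0 < w j → OnCurve ω (upright R 0 j)
    left    : ∀ j → 0 < w j → OnCurve ω (upright R (w j) j)
    treads  : ∀ j t → Differ t (below w j) (w j) → OnCurve ω (tread R t j)

col-mono : ∀ R {s t} → s ≤ t → col R t ℤ.≤ col R s
col-mono R s≤t = ℤₚ.+-monoʳ-≤ R (ℤₚ.neg-mono-≤ (+≤+ s≤t))

col-injective : ∀ R {s t} → col R s ≡ col R t → s ≡ t
col-injective R {s} {t} e = ℤₚ.+-injective (trans (sym (lemma R (+ s))) (trans (cong (λ x → R ℤ.- x) e) (lemma R (+ t))))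
  where
  lemma : ∀ R s → R ℤ.- (R ℤ.- s) ≡ s
  lemma = solve-∀

allowed-vertical : ∀ {R w e x y} → Allowed R w e →
  e ≡ ((x , y) , (x , y ℤ.+ + 1)) ⊎ swap e ≡ ((x , y) , (x , y ℤ.+ + 1)) →
  ∃[ j ] ∃[ s ] y ≡ + j × x ≡ col R s × (s ≡ 0 ⊎ s ≡ w j)
allowed-vertical a e = go a (Sum.map split split e)
  where
  split : ∀ {a b : Site} {c d} → (a , b) ≡ (c , d) → a ≡ c × b ≡ d
  split refl = refl , refl
  y≢y+1 : ∀ y → y ≢ y ℤ.+ + 1
  y≢y+1 y e = x<x+k y 1≤1 (ℤₚ.≤-reflexive (sym e))
  two-up : ∀ j {y} → + suc j ≡ y → + j ≢ y ℤ.+ + 1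
  two-up j refl e = ℕₚ.m≢1+m+n j (trans (ℤₚ.+-injective e) refl)
  go : ∀ {R w p p′ x y} → Allowed R w (p , p′) →
    (p ≡ (x , y) × p′ ≡ (x , y ℤ.+ + 1)) ⊎ (p′ ≡ (x , y) × p ≡ (x , y ℤ.+ + 1)) →
    ∃[ j ] ∃[ s ] y ≡ + j × x ≡ col R s × (s ≡ 0 ⊎ s ≡ w j)
  go {y = y} level (inj₁ (refl , e)) = contradiction (cong proj₂ e) (y≢y+1 y)
  go {y = y} level (inj₂ (refl , e)) = contradiction (cong proj₂ e) (y≢y+1 y)
  go (up h)   (inj₁ (refl , _)) = _ , _ , refl , refl , h
  go (up {j = j} h) (inj₂ (refl , e)) = contradiction (cong proj₂ e) (two-up j refl)
  go (down {j = j} h) (inj₁ (refl , e)) = contradiction (cong proj₂ e) (two-up j refl)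
  go (down h) (inj₂ (refl , _)) = _ , _ , refl , refl , h

move-suc : ∀ k d p → move (suc k) d p ≡ move 1 d (move k d p)
move-suc k d (x , y) = go d
  where
  plus : ∀ x k → x ℤ.+ (+ 1 ℤ.+ k) ≡ (x ℤ.+ k) ℤ.+ + 1
  plus = solve-∀
  minus : ∀ x k → x ℤ.- (+ 1 ℤ.+ k) ≡ (x ℤ.- k) ℤ.- + 1
  minus = solve-∀
  go : ∀ d → move (suc k) d (x , y) ≡ move 1 d (move k d (x , y))
  go north = cong (x ,_) (plus y (+ k))
  go south = cong (x ,_) (minus y (+ k))
  go east  = cong (_, y) (plus x (+ k))
  go west  = cong (_, y) (minus x (+ k))

move-zero : ∀ d p → move 0 d p ≡ p
move-zero north (x , y) = cong (x ,_) (ℤₚ.+-identityʳ y)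
move-zero south (x , y) = cong (x ,_) (ℤₚ.+-identityʳ y)
move-zero east  (x , y) = cong (_, y) (ℤₚ.+-identityʳ x)
move-zero west  (x , y) = cong (_, y) (ℤₚ.+-identityʳ x)

ray : ∀ {ω} d c → (∀ k → ¬ OnCurve ω (side d (move k d c))) → ∀ k → Star (Open ω) c (move k d c)
ray d c free zero    = subst (Star _ c) (sym (move-zero d c)) ε
ray d c free (suc k) = ray d c free k ◅◅ (d , move-suc k d c , free k) ◅ ε

Free : Walk → Cell → Direction → Set
Free ω c d = ∀ k → ¬ OnCurve ω (side d (move k d c))

-- The cell at distance r + |x| + 1 along the ray violates the bound r, by the triangle inequality.
free-east⇒¬enclosed : ∀ {ω c} → Free ω c east → ¬ Enclosed ω c
free-east⇒¬enclosed {c = x , y} free (r , b) = ℕₚ.1+n≰n (begin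
  suc (r + ∣ x ∣)                ≡⟨ cong ∣_∣ (sym (lemma x (+ k))) ⟩
  ∣ x ℤ.+ + k ℤ.- x ∣            ≤⟨ ℤₚ.∣i-j∣≤∣i∣+∣j∣ (x ℤ.+ + k) x ⟩
  ∣ x ℤ.+ + k ∣ + ∣ x ∣          ≤⟨ ℕₚ.+-monoˡ-≤ ∣ x ∣ (proj₁ (b _ (ray east (x , y) free k))) ⟩
  r + ∣ x ∣                      ∎)
  where
  open ℕₚ.≤-Reasoning
  k = suc (r + ∣ x ∣)
  lemma : ∀ x k → x ℤ.+ k ℤ.- x ≡ k
  lemma = solve-∀

free-west⇒¬enclosed : ∀ {ω c} → Free ω c west → ¬ Enclosed ω c
free-west⇒¬enclosed {c = x , y} free (r , b) = ℕₚ.1+n≰n (begin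
  suc (∣ x ∣ + r)                ≡⟨ cong ∣_∣ (sym (lemma x (+ k))) ⟩
  ∣ x ℤ.- (x ℤ.- + k) ∣          ≤⟨ ℤₚ.∣i-j∣≤∣i∣+∣j∣ x (x ℤ.- + k) ⟩
  ∣ x ∣ + ∣ x ℤ.- + k ∣          ≤⟨ ℕₚ.+-monoʳ-≤ ∣ x ∣ (proj₁ (b _ (ray west (x , y) free k))) ⟩
  ∣ x ∣ + r                      ∎)
  where
  open ℕₚ.≤-Reasoning
  k = suc (∣ x ∣ + r)
  lemma : ∀ x k → x ℤ.- (x ℤ.- k) ≡ k
  lemma = solve-∀

Inside : ℤ → (ℕ → ℕ) → Cell → Set
Inside R w c = ∃[ j ] ∃[ t ] c ≡ (col R (suc t) , + j) × t < w j

module _ {ω R w} (O : Outline ω R w) where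
  open Outline O

  curve-vertical : ∀ {x y} → OnCurve ω ((x , y) , (x , y ℤ.+ + 1)) →
    ∃[ j ] ∃[ s ] y ≡ + j × x ≡ col R s × (s ≡ 0 ⊎ s ≡ w j)
  curve-vertical (inj₁ m) = allowed-vertical (All.lookup allowed m) (inj₁ refl)
  curve-vertical (inj₂ m) = allowed-vertical (All.lookup allowed m) (inj₂ refl)

  -- A step that would leave the region crosses the wall, the left end of a row, or a tread where
  -- two consecutive widths differ; all of these are on the curve.
  inside-step : ∀ {c c′} → Inside R w c → Open ω c c′ → Inside R w c′
  inside-step (j , t , refl , t<w) (north , refl , free) with t ℕₚ.<? w (suc j)
  ... | yes t<w′ = suc j , t , north-step _ j , t<w′
  ... | no  t≮w′ = contradiction
    (subst (OnCurve ω) (cong₂ _,_ (sym (north-step _ j))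
      (cong₂ _,_ (sym (col-east R t)) (sym (+suc j))))
      (treads (suc j) t (inj₁ (t<w , ℕₚ.≮⇒≥ t≮w′)))) free
  inside-step (zero , t , refl , t<w) (south , refl , free) = contradiction
    (subst (OnCurve ω) (cong (_,_ (col R (suc t) , + 0)) (sym (east-step R t _))) (treads 0 t (inj₂ (t<w , z≤n)))) free
  inside-step (suc j , t , refl , t<w) (south , refl , free) with t ℕₚ.<? w j
  ... | yes t<w′ = j , t , refl , t<w′
  ... | no  t≮w′ = contradiction
    (subst (OnCurve ω) (cong (_,_ (col R (suc t) , + suc j)) (sym (east-step R t _)))
      (treads (suc j) t (inj₂ (t<w , ℕₚ.≮⇒≥ t≮w′)))) free
  inside-step (j , zero , refl , t<w) (east , refl , free) = contradiction
    (subst (OnCurve ω) (cong₂ _,_ (sym (east-step R 0 _))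
      (cong₂ _,_ (sym (col-east R 0)) (sym (+suc j)))) (right j t<w)) free
  inside-step (j , suc t , refl , t<w) (east , refl , free) =
    j , t , east-step R (suc t) _ , ℕₚ.<⇒≤ t<w
  inside-step (j , t , refl , t<w) (west , refl , free) with suc t ℕₚ.<? w j
  ... | yes t<w′ = j , suc t , west-step R (suc t) _ , t<w′
  ... | no  t≮w′ = contradiction
    (subst (OnCurve ω) (cong₂ _,_ (cong (λ s → col R s , + j) w≡)
       (cong₂ _,_ (cong (col R) w≡) (sym (+suc j))))
      (left j (ℕₚ.≤-<-trans z≤n t<w))) free
    where
    w≡ : w j ≡ suc t
    w≡ = ℕₚ.≤-antisym (ℕₚ.≮⇒≥ t≮w′) t<w

  inside-star : ∀ {c c′} → Inside R w c → Star (Open ω) c c′ → Inside R w c′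
  inside-star i ε       = i
  inside-star i (o ◅ s) = inside-star (inside-step i o) s

  free-below : ∀ x n → Free ω (x , -[1+ n ]) east
  free-below x n k on with _ , _ , () , _ ← curve-vertical on

  free-right : ∀ n y → Free ω (R ℤ.+ + n , y) east
  free-right n y k on with _ , s , _ , e , _ ← curve-vertical on =
    x<x+k R {n + k + 1} (ℕₚ.m≤n+m 1 (n + k)) (begin
      R ℤ.+ (+ (n + k + 1))        ≡⟨ lemma R (+ n) (+ k) ⟩
      R ℤ.+ + n ℤ.+ + k ℤ.+ + 1    ≡⟨ e ⟩
      col R s                      ≤⟨ col-mono R z≤n ⟩
      col R 0                      ≡⟨ ℤₚ.+-identityʳ R ⟩
      R                            ∎)
    where
    open ℤₚ.≤-Reasoning
    lemma : ∀ R n k → R ℤ.+ (n ℤ.+ k ℤ.+ + 1) ≡ R ℤ.+ n ℤ.+ k ℤ.+ + 1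
    lemma = solve-∀

  free-left : ∀ t j → w j ≤ t → Free ω (col R (suc t) , + j) west
  free-left t j w≤t k on with _ , s , refl , e , h ← curve-vertical on =
    x-k<x (col R t) {suc k} (s≤s z≤n) (begin
      col R t                 ≤⟨ col-mono R (s≤t h) ⟩
      col R s                 ≡⟨ sym e ⟩
      col R (suc t) ℤ.- + k   ≡⟨ lemma R (+ t) (+ k) ⟩
      col R t ℤ.- + suc k     ∎)
    where
    open ℤₚ.≤-Reasoning
    lemma : ∀ R t k → R ℤ.- (+ 1 ℤ.+ t) ℤ.- k ≡ R ℤ.- t ℤ.- (+ 1 ℤ.+ k)
    lemma = solve-∀
    s≤t : s ≡ 0 ⊎ s ≡ w j → s ≤ t
    s≤t (inj₁ refl) = z≤n
    s≤t (inj₂ refl) = w≤t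

  -- Cells below height 0 or right of the wall escape east, all others outside the region escape
  -- west. Above the stack `w j` is 0, so those cells fall under the same cases.
  enclosed⇒inside : ∀ c → Enclosed ω c → Inside R w c
  enclosed⇒inside (x , -[1+ n ]) enc = contradiction enc (free-east⇒¬enclosed (free-below x n))
  -- The integer R - x - 1 is the `t` with x = `col R (suc t)`; it is negative exactly for cells
  -- right of the wall.
  enclosed⇒inside (x , + j) enc = go (R ℤ.- x ℤ.- + 1) refl
    where
    lemma : ∀ R x → x ≡ R ℤ.- (+ 1 ℤ.+ (R ℤ.- x ℤ.- + 1))
    lemma = solve-∀
    lemma′ : ∀ R x → x ≡ R ℤ.+ (ℤ.- (R ℤ.- x ℤ.- + 1) ℤ.- + 1)
    lemma′ = solve-∀
    go : ∀ z → R ℤ.- x ℤ.- + 1 ≡ z → Inside R w (x , + j)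
    go (+ t) e with t ℕₚ.<? w j
    ... | yes t<w = j , t , cong (_, + j) (trans (lemma R x) (cong (λ z → R ℤ.- (+ 1 ℤ.+ z)) e)) , t<w
    ... | no  t≮w = contradiction enc (free-west⇒¬enclosed
          (subst (λ x → Free ω (x , + j) west)
            (sym (trans (lemma R x) (cong (λ z → R ℤ.- (+ 1 ℤ.+ z)) e)))
            (free-left t j (ℕₚ.≮⇒≥ t≮w))))
    go -[1+ n ] e = contradiction enc (free-east⇒¬enclosed
          (subst (λ x → Free ω (x , + j) east)
            (sym (trans (lemma′ R x) (cong (λ z → R ℤ.+ (ℤ.- z ℤ.- + 1)) e)))
            (free-right n (+ j))))

-- The cells of a stack of rows

area : List ℕ → ℕ
area []       = 0
area (a ∷ as) = suc a + area as

row : ℤ → ℕ → ℕ → List Cell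
row R y n = map (λ t → col R (suc t) , + y) (upTo n)

cells : ℤ → ℕ → List ℕ → List Cell
cells R y []       = []
cells R y (a ∷ as) = row R y (suc a) ++ cells R (suc y) as

length-cells : ∀ R y as → length (cells R y as) ≡ area as
length-cells R y []       = refl
length-cells R y (a ∷ as) = trans (length-++ (row R y (suc a)))
  (cong₂ _+_ (trans (length-map _ (upTo (suc a))) (length-upTo (suc a))) (length-cells R (suc y) as))

∈-cells⁻ : ∀ {R c} y as → c ∈ cells R y as →
  ∃[ i ] ∃[ t ] c ≡ (col R (suc t) , + (y + i)) × t < width as i
∈-cells⁻ {R} y (a ∷ as) m with ∈-++⁻ (row R y (suc a)) m
... | inj₁ m′ with t , t∈ , refl ← ∈-map⁻ _ m′ =
  0 , t , cong (λ z → col R (suc t) , + z) (sym (ℕₚ.+-identityʳ y)) , ∈-upTo⁻ t∈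
... | inj₂ m′ with i , t , refl , t< ← ∈-cells⁻ (suc y) as m′ =
  suc i , t , cong (λ z → col R (suc t) , + z) (sym (ℕₚ.+-suc y i)) , t<

∈-cells⁺ : ∀ {R} y as i {t} → t < width as i → (col R (suc t) , + (y + i)) ∈ cells R y as
∈-cells⁺ {R} y (a ∷ as) zero {t} t< = ∈-++⁺ˡ
  (subst (λ z → (col R (suc t) , + z) ∈ row R y (suc a)) (sym (ℕₚ.+-identityʳ y))
    (∈-map⁺ (λ t → col R (suc t) , + y) (∈-upTo⁺ t<)))
∈-cells⁺ {R} y (a ∷ as) (suc i) {t} t< = ∈-++⁺ʳ (row R y (suc a))
  (subst (λ z → (col R (suc t) , + z) ∈ cells R (suc y) as) (sym (ℕₚ.+-suc y i))
    (∈-cells⁺ (suc y) as i t<))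

unique-cells : ∀ R y as → Unique (cells R y as)
unique-cells R y []       = []
unique-cells R y (a ∷ as) = Uniqueₚ.++⁺
  (Uniqueₚ.map⁺ (ℕₚ.suc-injective ∘ col-injective R ∘ cong proj₁) (Uniqueₚ.upTo⁺ (suc a)))
  (unique-cells R (suc y) as)
  λ (m , m′) → disjoint m m′
  where
  disjoint : ∀ {c} → c ∈ row R y (suc a) → c ∉ cells R (suc y) as
  disjoint m m′ with _ , _ , refl ← ∈-map⁻ _ m | i , _ , e , _ ← ∈-cells⁻ (suc y) as m′ =
    ℕₚ.m≢1+m+n y (ℤₚ.+-injective (cong proj₂ e))

∈⇒≤sum : ∀ {A : Set} (f : A → ℕ) {x xs} → x ∈ xs → f x ≤ sum (map f xs)
∈⇒≤sum f (here refl) = ℕₚ.m≤m+n _ _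
∈⇒≤sum f (there m)   = ℕₚ.≤-trans (∈⇒≤sum f m) (ℕₚ.m≤n+m _ _)

outline⇒area : ∀ {ω R} as → Outline ω R (width as) → HasArea ω (area as)
outline⇒area {ω} {R} as O = cells R 0 as , unique-cells R 0 as , length-cells R 0 as ,
  λ c → mk⇔ (enclosed ∘ ∈-cells⁻ 0 as) (inside⇒∈ ∘ enclosed⇒inside O c)
  where
  inside⇒∈ : ∀ {c} → Inside R (width as) c → c ∈ cells R 0 as
  inside⇒∈ (j , t , refl , t<) = ∈-cells⁺ 0 as j t<
  norm : Cell → ℕ
  norm (x , y) = ∣ x ∣ + ∣ y ∣
  enclosed : ∀ {c} → Inside R (width as) c → Enclosed ω c
  -- A path never leaves the finite region, so the sum of all its norms is a crude common bound.
  enclosed i = sum (map norm (cells R 0 as)) , λ c s →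
    let b = ∈⇒≤sum norm (inside⇒∈ (inside-star O i s))
    in ℕₚ.≤-trans (ℕₚ.m≤m+n _ _) b , ℕₚ.≤-trans (ℕₚ.m≤n+m _ _) b

-- The curves of piles and bars

edgesFrom : Site → Walk → List Edge
edgesFrom p []      = [ p , origin ]
edgesFrom p (d ∷ v) = (p , move 1 d p) ∷ edgesFrom (move 1 d p) v

zip-sites : ∀ p v → let S = sitesFrom p v ++ [ origin ] in zip S (drop 1 S) ≡ edgesFrom p v
zip-sites p []           = refl
zip-sites p (d ∷ [])     = refl
zip-sites p (d ∷ d′ ∷ v) = cong (_ ∷_) (zip-sites (move 1 d p) (d′ ∷ v))

edges≡ : ∀ ω → edges ω ≡ edgesFrom origin ω
edges≡ = zip-sites origin

_∈±_ : Edge → List Edge → Set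
e ∈± E = e ∈ E ⊎ swap e ∈ E

∈±⇒onCurve : ∀ ω {e} → e ∈± edgesFrom origin ω → OnCurve ω e
∈±⇒onCurve ω = subst (_ ∈±_) (sym (edges≡ ω))

closing∈ : ∀ p v → (endpointFrom p v , origin) ∈ edgesFrom p v
closing∈ p []      = here refl
closing∈ p (d ∷ v) = there (closing∈ (move 1 d p) v)

edges-++ʳ : ∀ p u {v e} → e ∈ edgesFrom (endpointFrom p u) v → e ∈ edgesFrom p (u ++ v)
edges-++ʳ p []      m = m
edges-++ʳ p (d ∷ u) m = there (edges-++ʳ (move 1 d p) u m)

edges-north : ∀ x y v →
  edgesFrom (x , + y) (north ∷ v) ≡ ((x , + y) , (x , + suc y)) ∷ edgesFrom (x , + suc y) v
edges-north x y v = cong (λ p → ((x , + y) , p) ∷ edgesFrom p v) (north-step x y)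

module _ (R : ℤ) where

  after-turn : ∀ s t y {v e} → e ∈ edgesFrom (col R t , y) v →
    e ∈ edgesFrom (col R s , y) (turn s t ++ v)
  after-turn s t y {v} {e} m = edges-++ʳ (col R s , y) (turn s t)
    (subst (λ p → e ∈ edgesFrom p v) (sym (endpoint-turn R s t y)) m)

  after-row : ∀ s t y {v e} → e ∈ edgesFrom (col R t , + suc y) v →
    e ∈ edgesFrom (col R s , + y) (turn s t ++ north ∷ v)
  after-row s t y {v} {e} m = after-turn s t (+ y)
    (subst (e ∈_) (sym (edges-north (col R t) y v)) (there m))

  turn-upright : ∀ s t y v → upright R t y ∈ edgesFrom (col R s , + y) (turn s t ++ north ∷ v)
  turn-upright s t y v = after-turn s t (+ y)
    (subst (upright R t y ∈_) (sym (edges-north (col R t) y v)) (here refl))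

  turn-tread : ∀ {s t k} y v → Differ k s t → tread R k y ∈± edgesFrom (col R s , + y) (turn s t ++ v)
  turn-tread {s} {t} {k} y v = Sum.map
    (λ (k<s , t≤k) → eastward-tread (eastRun (ℕₚ.≤⇒≤′ (ℕₚ.≤-trans t≤k (ℕₚ.<⇒≤ k<s)))) refl k<s t≤k)
    (λ (k<t , s≤k) → westward-tread (westRun (ℕₚ.≤⇒≤‴ (ℕₚ.≤-trans s≤k (ℕₚ.<⇒≤ k<t)))) refl k<t s≤k)
    where
    eastward-tread : ∀ {s u p} → EastRun t s u → p ≡ (col R s , + y) → k < s → t ≤ k →
      tread R k y ∈ edgesFrom p (u ++ v)
    eastward-tread done refl k<s t≤k = contradiction k<s (ℕₚ.≤⇒≯ t≤k)
    eastward-tread {suc s} (step _ r) refl k<s t≤k with k ℕₚ.≟ s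
    ... | yes refl = here (cong ((col R (suc k) , + y) ,_) (sym (east-step R k (+ y))))
    ... | no  k≢s  = there (eastward-tread r (east-step R s (+ y)) (ℕₚ.≤∧≢⇒< (s≤s⁻¹ k<s) k≢s) t≤k)
    westward-tread : ∀ {s u p} → WestRun t s u → p ≡ (col R s , + y) → k < t → s ≤ k →
      swap (tread R k y) ∈ edgesFrom p (u ++ v)
    westward-tread done refl k<t s≤k = contradiction k<t (ℕₚ.≤⇒≯ s≤k)
    westward-tread {s} (step _ r) refl k<t s≤k with s ℕₚ.≟ k
    ... | yes refl = here (cong ((col R k , + y) ,_) (sym (west-step R k (+ y))))
    ... | no  s≢k  = there (westward-tread r (west-step R s (+ y)) k<t (ℕₚ.≤∧≢⇒< s≤k s≢k))

  module _ {w : ℕ → ℕ} where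

    allowed-turn : ∀ s t y v → All (Allowed R w) (edgesFrom (col R t , y) v) →
      All (Allowed R w) (edgesFrom (col R s , y) (turn s t ++ v))
    allowed-turn s t y v a =
      [ (λ r → eastward-allowed r refl) , (λ r → westward-allowed r refl) ]′ (turn-run s t)
      where
      eastward-allowed : ∀ {s u p} → EastRun t s u → p ≡ (col R s , y) →
        All (Allowed R w) (edgesFrom p (u ++ v))
      eastward-allowed done refl = a
      eastward-allowed {suc s} (step _ r) refl = level ∷ eastward-allowed r (east-step R s y)
      westward-allowed : ∀ {s u p} → WestRun t s u → p ≡ (col R s , y) →
        All (Allowed R w) (edgesFrom p (u ++ v))
      westward-allowed done refl = a
      westward-allowed {s} (step _ r) refl = level ∷ westward-allowed r (west-step R s y)

    allowed-row : ∀ s y v → All (Allowed R w) (edgesFrom (col R (w y) , + suc y) v) →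
      All (Allowed R w) (edgesFrom (col R s , + y) (turn s (w y) ++ north ∷ v))
    allowed-row s y v a = allowed-turn s (w y) (+ y) (north ∷ v)
      (subst (All (Allowed R w)) (sym (edges-north (col R (w y)) y v)) (up (inj₂ refl) ∷ a))

    allowed-south : ∀ y → All (Allowed R w) (edgesFrom (col R 0 , + y) (replicate y south))
    allowed-south zero    = level ∷ []
    allowed-south (suc y) = down (inj₁ refl) ∷ allowed-south y

    allowed-climb : ∀ s as y → (∀ i → w (y + i) ≡ width as i) →
      All (Allowed R w) (edgesFrom (col R s , + y) (climb s as y))
    allowed-climb s [] y h = allowed-turn s 0 (+ y) (replicate y south) (allowed-south y)
    allowed-climb s (a ∷ as) y h =
      subst (λ t → All (Allowed R w) (edgesFrom (col R s , + y) (turn s t ++ north ∷ v)))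
        w≡ (allowed-row s y v
          (subst (λ t → All (Allowed R w) (edgesFrom (col R t , + suc y) v)) (sym w≡)
            (allowed-climb (suc a) as (suc y)
              (λ i → trans (cong w (sym (ℕₚ.+-suc y i))) (h (suc i))))))
      where
      v = climb (suc a) as (suc y)
      w≡ : w y ≡ suc a
      w≡ = trans (cong w (sym (ℕₚ.+-identityʳ y))) (h 0)

  south-upright : ∀ y j → j < y →
    swap (upright R 0 j) ∈ edgesFrom (col R 0 , + y) (replicate y south)
  south-upright (suc y) j j<y with j ℕₚ.≟ y
  ... | yes refl = here refl
  ... | no  j≢y  = there (south-upright y j (ℕₚ.≤∧≢⇒< (s≤s⁻¹ j<y) j≢y))

  climb-right : ∀ s as y j → j < y + length as →
    swap (upright R 0 j) ∈ edgesFrom (col R s , + y) (climb s as y)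
  climb-right s [] y j j< =
    after-turn s 0 (+ y) (south-upright y j (subst (j <_) (ℕₚ.+-identityʳ y) j<))
  climb-right s (a ∷ as) y j j< = after-row s (suc a) y
    (climb-right (suc a) as (suc y) j (subst (j <_) (ℕₚ.+-suc y (length as)) j<))

  climb-left : ∀ s as y i → 0 < width as i →
    upright R (width as i) (y + i) ∈ edgesFrom (col R s , + y) (climb s as y)
  climb-left s (a ∷ as) y zero w>0 =
    subst (λ j → upright R (suc a) j ∈ edgesFrom (col R s , + y) (climb s (a ∷ as) y))
      (sym (ℕₚ.+-identityʳ y)) (turn-upright s (suc a) y (climb (suc a) as (suc y)))
  climb-left s (a ∷ as) y (suc i) w>0 =
    subst (λ j → upright R (width as i) j ∈ edgesFrom (col R s , + y) (climb s (a ∷ as) y))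
      (sym (ℕₚ.+-suc y i)) (after-row s (suc a) y (climb-left (suc a) as (suc y) i w>0))

  -- The starting column `suc s` is read as the width of a row underneath, which is what the
  -- recursion passes on to the next row.
  climb-tread : ∀ s as y i k → Differ k (width (s ∷ as) i) (width as i) →
    tread R k (y + i) ∈± edgesFrom (col R (suc s) , + y) (climb (suc s) as y)
  climb-tread s [] y zero k k∈ =
    subst (λ j → tread R k j ∈± edgesFrom (col R (suc s) , + y) (climb (suc s) [] y))
      (sym (ℕₚ.+-identityʳ y)) (turn-tread y (replicate y south) k∈)
  climb-tread s [] y (suc i) k (inj₁ (() , _))
  climb-tread s [] y (suc i) k (inj₂ (() , _))
  climb-tread s (a ∷ as) y zero k k∈ =
    subst (λ j → tread R k j ∈± edgesFrom (col R (suc s) , + y) (climb (suc s) (a ∷ as) y))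
      (sym (ℕₚ.+-identityʳ y)) (turn-tread y (north ∷ climb (suc a) as (suc y)) k∈)
  climb-tread s (a ∷ as) y (suc i) k k∈ =
    subst (λ j → tread R k j ∈± edgesFrom (col R (suc s) , + y) (climb (suc s) (a ∷ as) y))
      (sym (ℕₚ.+-suc y i))
      (Sum.map (after-row (suc s) (suc a) y) (after-row (suc s) (suc a) y)
        (climb-tread a as (suc y) i k k∈))

width⇒<length : ∀ as i → 0 < width as i → i < length as
width⇒<length (a ∷ as) zero    w>0 = s≤s z≤n
width⇒<length (a ∷ as) (suc i) w>0 = s≤s (width⇒<length as i w>0)

pile-outline : ∀ a as → Outline (pile (a , as)) 1ℤ (width (a ∷ as))
pile-outline a as = record
  { allowed = subst (All _) (sym (edges≡ ω)) (allowed-climb 1ℤ 1 (a ∷ as) 0 (λ _ → refl))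
  ; right   = λ j w>0 → ∈±⇒onCurve ω
                (inj₂ (climb-right 1ℤ 1 (a ∷ as) 0 j (width⇒<length (a ∷ as) j w>0)))
  ; left    = λ j w>0 → ∈±⇒onCurve ω (inj₁ (climb-left 1ℤ 1 (a ∷ as) 0 j w>0))
  ; treads  = λ j k k∈ → ∈±⇒onCurve ω (treads j k k∈)
  }
  where
  ω = pile (a , as)
  treads : ∀ j k → Differ k (below (width (a ∷ as)) j) (width (a ∷ as) j) →
    tread 1ℤ k j ∈± edgesFrom origin ω
  -- The walk starts in column 1, at x = 0, so the bottom edge of the cell next to the wall is the
  -- closing edge from (1 , 0). The rest of the bottom is the run of the first row, seen from a row
  -- of width 1 underneath.
  treads zero zero k∈ =
    inj₂ (subst (λ p → (p , origin) ∈ edgesFrom origin ω) (endpoint-pile (a , as)) (closing∈ origin ω))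
  treads zero (suc k) (inj₂ (k< , _)) = climb-tread 1ℤ 0 (a ∷ as) 0 0 (suc k) (inj₂ (k< , s≤s z≤n))
  treads (suc j) k k∈ = climb-tread 1ℤ 0 (a ∷ as) 0 (suc j) k k∈

-- A bar is a single row whose wall is x = 0 rather than x = 1.
bar-outline : ∀ n → Outline (bar (suc n)) 0ℤ (width [ n ])
bar-outline n = record
  { allowed = subst (All _) (sym (edges≡ ω))
      (allowed-row 0ℤ 0 0 (turn (suc n) 0)
        (subst (λ v → All (Allowed 0ℤ (width [ n ])) (edgesFrom (col 0ℤ (suc n) , 1ℤ) v)) (++-identityʳ (turn (suc n) 0))
          (allowed-turn 0ℤ (suc n) 0 1ℤ [] (down (inj₁ refl) ∷ []))))
  ; right   = λ { zero _ → ∈±⇒onCurve ω (inj₂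
      (subst (λ p → (p , origin) ∈ edgesFrom origin ω) (endpoint-bar (suc n)) (closing∈ origin ω))) }
  ; left    = λ { zero _ → ∈±⇒onCurve ω (inj₁ (turn-upright 0ℤ 0 (suc n) 0 (turn (suc n) 0))) }
  ; treads  = λ j k k∈ → ∈±⇒onCurve ω (treads j k k∈)
  }
  where
  ω = bar (suc n)
  treads : ∀ j k → Differ k (below (width [ n ]) j) (width [ n ] j) →
    tread 0ℤ k j ∈± edgesFrom origin ω
  treads zero k k∈ = turn-tread 0ℤ 0 (north ∷ turn (suc n) 0) k∈
  treads (suc zero) k k∈ = Sum.map (after-row 0ℤ 0 (suc n) 0) (after-row 0ℤ 0 (suc n) 0)
    (subst (λ v → tread 0ℤ k 1 ∈± edgesFrom (col 0ℤ (suc n) , 1ℤ) v) (++-identityʳ (turn (suc n) 0))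
      (turn-tread 0ℤ 1 [] k∈))
  treads (suc (suc j)) k (inj₁ (() , _))
  treads (suc (suc j)) k (inj₂ (() , _))

area-pile : ∀ a as → HasArea (pile (a , as)) (area (a ∷ as))
area-pile a as = outline⇒area (a ∷ as) (pile-outline a as)

area-bar : ∀ n → HasArea (bar (suc n)) (suc n)
area-bar n = subst (HasArea (bar (suc n))) (ℕₚ.+-identityʳ (suc n))
  (outline⇒area [ n ] (bar-outline n))

-- Area under reflection, and uniqueness of sizes

reflectEdge : Edge → Edge
reflectEdge (p , p′) = reflect p , reflect p′

edges-mirror : ∀ p v → edgesFrom (reflect p) (mirror v) ≡ map reflectEdge (edgesFrom p v)
edges-mirror p []      = refl
edges-mirror p (d ∷ v) =
  trans (cong (λ p′ → (reflect p , p′) ∷ edgesFrom p′ (mirror v)) (move-flip 1 d p))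
        (cong (_ ∷_) (edges-mirror (move 1 d p) v))

onCurve-mirror : ∀ ω {e} → OnCurve ω e → OnCurve (mirror ω) (reflectEdge e)
onCurve-mirror ω = Sum.map mirrored mirrored
  where
  mirrored : ∀ {e} → e ∈ edges ω → reflectEdge e ∈ edges (mirror ω)
  mirrored m = subst (_ ∈_)
    (sym (trans (edges≡ (mirror ω)) (trans (edges-mirror origin ω) (cong (map reflectEdge) (sym (edges≡ ω))))))
    (∈-map⁺ reflectEdge m)

side-flip : ∀ d c → reflectEdge (side (flip d) (reflect c)) ≡ side d c
side-flip north c = refl
side-flip south c = refl
side-flip east  c = refl
side-flip west  c = refl

open-mirror : ∀ ω {c c′} → Open (mirror ω) c c′ → Open ω (reflect c) (reflect c′)
open-mirror ω {c} (d , refl , free) = flip d , sym (move-flip 1 d c) ,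
  λ on → free (subst (OnCurve (mirror ω)) (side-flip d c) (onCurve-mirror ω on))

enclosed-mirror : ∀ ω {c} → Enclosed ω (reflect c) → Enclosed (mirror ω) c
enclosed-mirror ω (r , b) = r , λ c′ s → swap (b (reflect c′) (gmap reflect (open-mirror ω) s))

area-mirror : ∀ {ω n} → HasArea ω n → HasArea (mirror ω) n
area-mirror {ω} (cs , u , ℓ , h) =
  map reflect cs , Uniqueₚ.map⁺ (λ { refl → refl }) u , trans (length-map reflect cs) ℓ ,
  λ c → mk⇔
    (λ m → enclosed-mirror ω (to (h (reflect c)) (∈-reflect⁻ m)))
    -- The converse is the same implication for `mirror ω`, as reflecting twice is the identity.
    (λ e → ∈-map⁺ reflect (from (h (reflect c))
      (subst (λ ω → Enclosed ω (reflect c)) (mirror-mirror ω) (enclosed-mirror (mirror ω) e))))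

-- Pigeonhole without decidable equality: the occurrence of the head is cut out of `ys`, and the
-- tail avoids it by uniqueness.
unique⊆⇒≤ : ∀ {A : Set} {xs ys : List A} → Unique xs → (∀ {x} → x ∈ xs → x ∈ ys) → length xs ≤ length ys
unique⊆⇒≤ {xs = []} _ _ = z≤n
unique⊆⇒≤ {xs = x ∷ xs} (x∉ ∷ u) ⊆ with us , vs , refl ← ∈-∃++ (⊆ (here refl)) =
  subst (suc (length xs) ≤_)
    (sym (trans (length-++ us) (trans (ℕₚ.+-suc (length us) (length vs)) (cong suc (sym (length-++ us))))))
    (s≤s (unique⊆⇒≤ u λ m → avoid m (∈-++⁻ us (⊆ (there m)))))
  where
  avoid : ∀ {y} → y ∈ xs → y ∈ us ⊎ y ∈ x ∷ vs → y ∈ us ++ vs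
  avoid m (inj₁ y∈)          = ∈-++⁺ˡ y∈
  avoid m (inj₂ (here refl)) = contradiction refl (All.lookup x∉ m)
  avoid m (inj₂ (there y∈))  = ∈-++⁺ʳ us y∈

size-unique : ∀ {A : Set} {P : A → Set} {m n} → HasSize P m → HasSize P n → m ≡ n
size-unique (xs , uxs , refl , hx) (ys , uys , refl , hy) = ℕₚ.≤-antisym
  (unique⊆⇒≤ uxs λ m → from (hy _) (to (hx _) m))
  (unique⊆⇒≤ uys λ m → from (hx _) (to (hy _) m))

-- Counting

-- Recovers the rows of a pile: the argument s is the current column.
widths : ℕ → Walk → List ℕ
widths s []          = []
widths s (north ∷ v) = pred s ∷ widths s v
widths s (south ∷ v) = widths s v
widths s (east ∷ v)  = widths (pred s) v
widths s (west ∷ v)  = widths (suc s) v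

widths-turn : ∀ s t v → widths s (turn s t ++ v) ≡ widths t v
widths-turn s t v = [ eastward-widths , westward-widths ]′ (turn-run s t)
  where
  eastward-widths : ∀ {s u} → EastRun t s u → widths s (u ++ v) ≡ widths t v
  eastward-widths done       = refl
  eastward-widths (step _ r) = eastward-widths r
  westward-widths : ∀ {s u} → WestRun t s u → widths s (u ++ v) ≡ widths t v
  westward-widths done       = refl
  westward-widths (step _ r) = westward-widths r

widths-south : ∀ s y → widths s (replicate y south) ≡ []
widths-south s zero    = refl
widths-south s (suc y) = widths-south s y

widths-climb : ∀ s as y → widths s (climb s as y) ≡ as
widths-climb s []       y = trans (widths-turn s 0 (replicate y south)) (widths-south 0 y)
widths-climb s (a ∷ as) y = trans (widths-turn s (suc a) (north ∷ climb (suc a) as (suc y)))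
  (cong (a ∷_) (widths-climb (suc a) as (suc y)))

pile-injective : ∀ {as bs} → pile as ≡ pile bs → as ≡ bs
pile-injective {a , as} {b , bs} e
  with refl ← trans (sym (widths-climb 1 (a ∷ as) 0)) (trans (cong (widths 1) e) (widths-climb 1 (b ∷ bs) 0))
  = refl

size : ℕ × List ℕ → ℕ
size (a , as) = area (a ∷ as)

widen heighten : ℕ × List ℕ → ℕ × List ℕ
widen    (a , as) = suc a , as
heighten (a , as) = 0 , a ∷ as

-- A pair encodes a nonempty list of parts, each lowered by one. A composition of n + 2 has first
-- part at least 2 or equal to 1, so it arises from one of n + 1 by widening the first row or by
-- adding a single cell as a new first row; hence the doubling.
compositions : ℕ → List (ℕ × List ℕ)
compositions zero    = [ 0 , [] ]
compositions (suc n) = map widen (compositions n) ++ map heighten (compositions n)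

length-compositions : ∀ n → length (compositions n) ≡ 2 ^ n
length-compositions zero    = refl
length-compositions (suc n) = trans (length-++ (map widen (compositions n)))
  (cong₂ _+_ (trans (length-map widen (compositions n)) (length-compositions n))
    (trans (length-map heighten (compositions n))
      (trans (length-compositions n) (sym (ℕₚ.+-identityʳ (2 ^ n))))))

unique-compositions : ∀ n → Unique (compositions n)
unique-compositions zero    = [] ∷ []
unique-compositions (suc n) = Uniqueₚ.++⁺
  (Uniqueₚ.map⁺ (λ { refl → refl }) (unique-compositions n))
  (Uniqueₚ.map⁺ (λ { refl → refl }) (unique-compositions n))
  λ (m , m′) → disjoint m m′
  where
  disjoint : ∀ {c} → c ∈ map widen (compositions n) → c ∉ map heighten (compositions n)
  disjoint m m′ with _ , _ , refl ← ∈-map⁻ widen m | _ , _ , () ← ∈-map⁻ heighten m′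

∈-compositions⁻ : ∀ n {c} → c ∈ compositions n → size c ≡ suc n
∈-compositions⁻ zero (here refl) = refl
∈-compositions⁻ (suc n) m with ∈-++⁻ (map widen (compositions n)) m
... | inj₁ m′ with _ , c∈ , refl ← ∈-map⁻ widen m′    = cong suc (∈-compositions⁻ n c∈)
... | inj₂ m′ with _ , c∈ , refl ← ∈-map⁻ heighten m′ = cong suc (∈-compositions⁻ n c∈)

∈-compositions⁺ : ∀ n c → size c ≡ suc n → c ∈ compositions n
∈-compositions⁺ zero    (zero , [])     _ = here refl
∈-compositions⁺ (suc n) (suc a , as)    e =
  ∈-++⁺ˡ (∈-map⁺ widen (∈-compositions⁺ n (a , as) (ℕₚ.suc-injective e)))
∈-compositions⁺ (suc n) (zero , a ∷ as) e =
  ∈-++⁺ʳ (map widen (compositions n))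
    (∈-map⁺ heighten (∈-compositions⁺ n (a , as) (ℕₚ.suc-injective e)))

uppers : ℕ → List Walk
uppers n = bar (suc n) ∷ map pile (compositions n)

polygons : ℕ → List Walk
polygons n = uppers n ++ map mirror (uppers n)

length-polygons : ∀ n → length (polygons n) ≡ 2 ^ suc n + 2
length-polygons n = begin
  length (polygons n)        ≡⟨ length-++ (uppers n) ⟩
  ℓ + length (map mirror (uppers n)) ≡⟨ cong (λ k → ℓ + k) (length-map mirror (uppers n)) ⟩
  ℓ + ℓ                      ≡⟨ cong (λ k → suc k + suc k) (trans (length-map pile (compositions n)) (length-compositions n)) ⟩
  suc (2 ^ n) + suc (2 ^ n)  ≡⟨ lemma (2 ^ n) ⟩
  2 ^ suc n + 2              ∎
  where
  open ≡-Reasoning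
  ℓ = length (uppers n)
  lemma : ∀ k → suc k + suc k ≡ (k + (k + 0)) + 2
  lemma k = trans (cong suc (ℕₚ.+-suc k k)) (trans (ℕₚ.+-comm 2 (k + k))
    (cong (λ z → (k + z) + 2) (sym (ℕₚ.+-identityʳ k))))

data Upward : Walk → Set where
  north : ∀ {v} → Upward (north ∷ v)
  west  : ∀ {v} → Upward (west ∷ v)

upward-pile : ∀ c → Upward (pile c)
upward-pile (zero  , as) = north
upward-pile (suc a , as) = west

upward-mirror : ∀ {ω} → Upward ω → ¬ Upward (mirror ω)
upward-mirror north ()
upward-mirror west  ()

upward-uppers : ∀ n {ω} → ω ∈ uppers n → Upward ω
upward-uppers n (here refl) = west
upward-uppers n (there m) with c , _ , refl ← ∈-map⁻ pile m = upward-pile c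

mirror-injective : ∀ {ω ω′} → mirror ω ≡ mirror ω′ → ω ≡ ω′
mirror-injective {ω} {ω′} e =
  trans (sym (mirror-mirror ω)) (trans (cong mirror e) (mirror-mirror ω′))

-- Bars end at (0 , 1) and piles at (1 , 0), which separates them; the first step separates both
-- from their reflections.
unique-polygons : ∀ n → Unique (polygons n)
unique-polygons n = Uniqueₚ.++⁺ unique-uppers (Uniqueₚ.map⁺ mirror-injective unique-uppers)
  λ (m , m′) → disjoint m m′
  where
  bar≢ : ∀ {ω} → ω ∈ map pile (compositions n) → bar (suc n) ≢ ω
  bar≢ m e with c , _ , refl ← ∈-map⁻ pile m
    with () ← trans (sym (endpoint-bar (suc n))) (trans (cong endpoint e) (endpoint-pile c))
  unique-uppers : Unique (uppers n)
  unique-uppers = All.tabulate bar≢ ∷ Uniqueₚ.map⁺ pile-injective (unique-compositions n)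
  disjoint : ∀ {ω} → ω ∈ uppers n → ω ∉ map mirror (uppers n)
  disjoint m m′ with _ , m″ , refl ← ∈-map⁻ mirror m′ =
    upward-mirror (upward-uppers n m″) (upward-uppers n m)

PolygonOfArea : ℕ → Walk → Set
PolygonOfArea n ω = TwoSidedPrudentPolygon ω × HasArea ω n

∈-uppers⁻ : ∀ n {ω} → ω ∈ uppers n → PolygonOfArea (suc n) ω
∈-uppers⁻ n (here refl) = polygon-bar n , area-bar n
∈-uppers⁻ n (there m) with (a , as) , c∈ , refl ← ∈-map⁻ pile m =
  polygon-pile (a , as) , subst (HasArea (pile (a , as))) (∈-compositions⁻ n c∈) (area-pile a as)

-- The enclosed cells have only one count, so the given area fixes the length of the bar or the sum
-- of the composition.
∈-uppers⁺ : ∀ n {ω} → Upper ω → HasArea ω (suc n) → ω ∈ uppers n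
∈-uppers⁺ n (inj₁ ((a , as) , refl)) A = there (∈-map⁺ pile
  (∈-compositions⁺ n (a , as) (size-unique (area-pile a as) A)))
∈-uppers⁺ n (inj₂ (m , refl)) A with refl ← size-unique (area-bar m) A = here refl

∈-polygons⁻ : ∀ n {ω} → ω ∈ polygons n → PolygonOfArea (suc n) ω
∈-polygons⁻ n m with ∈-++⁻ (uppers n) m
... | inj₁ m′ = ∈-uppers⁻ n m′
... | inj₂ m′ with _ , m″ , refl ← ∈-map⁻ mirror m′
  with P , A ← ∈-uppers⁻ n m″ =
  polygon-mirror P , area-mirror A

∈-polygons⁺ : ∀ n {ω} → PolygonOfArea (suc n) ω → ω ∈ polygons n
∈-polygons⁺ n {ω} (P , A) with classify ω P
... | inj₁ U = ∈-++⁺ˡ (∈-uppers⁺ n U A)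
... | inj₂ U = ∈-++⁺ʳ (uppers n) (subst (_∈ map mirror (uppers n)) (mirror-mirror ω)
        (∈-map⁺ mirror (∈-uppers⁺ n U (area-mirror A))))

-- The generating function

-- The hypotheses say f = c and g = 1 - a q. One step of long division leaves the constant c a as
-- the new dividend, so the same form recurs.
geometric : ∀ {f g : Series} g₀ {c a} → f 0 ≡ c → (∀ k → f (suc k) ≡ 0ℤ) →
  g 1 ≡ ℤ.- a → (∀ k → g (suc (suc k)) ≡ 0ℤ) → ∀ n → (f / g [ g₀ ]) n ≡ c ℤ.* a ℤ.^ n
geometric g₀ {c} f0 f+ g1 g+ zero = trans f0 (sym (ℤₚ.*-identityʳ c))
geometric {f} {g} g₀ {c} {a} f0 f+ g1 g+ (suc n) = trans
  (geometric g₀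
    (trans (cong₂ ℤ._-_ (f+ 0) (cong₂ ℤ._*_ f0 g1)) (lemma c a))
    (λ k → trans (cong₂ ℤ._-_ (f+ (suc k)) (cong (f 0 ℤ.*_) (g+ k))) (lemma′ (f 0)))
    g1 g+ n)
  (ℤₚ.*-assoc c a (a ℤ.^ n))
  where
  lemma : ∀ c a → 0ℤ ℤ.- c ℤ.* (ℤ.- a) ≡ c ℤ.* a
  lemma = solve-∀
  lemma′ : ∀ x → 0ℤ ℤ.- x ℤ.* 0ℤ ≡ 0ℤ
  lemma′ = solve-∀

pos-^ : ∀ m n → + (m ^ n) ≡ (+ m) ℤ.^ n
pos-^ m zero    = refl
pos-^ m (suc n) = trans (ℤₚ.pos-* m (m ^ n)) (cong (+ m ℤ.*_) (pos-^ m n))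

series : genFun (λ n → 2 ^ n + 2) ≗
  ((+ 2 · q) / (𝟏 ⊖ + 2 · q) [ refl ]) ⊕ ((+ 2 · q) / (𝟏 ⊖ q) [ refl ])
series zero    = refl
-- The dividend 2q has constant term 0, so the first division step merely shifts it to the constant
-- 2, and coefficient n of a geometric series remains.
series (suc n) = cong₂ ℤ._+_
  (trans (pos-^ 2 (suc n)) (sym (geometric refl refl (λ _ → refl) refl (λ _ → refl) n)))
  (trans (cong (+ 2 ℤ.*_) (sym (ℤₚ.^-zeroˡ n))) (sym (geometric refl refl (λ _ → refl) refl (λ _ → refl) n)))

proposition1 : Σ[ PA ∈ (ℕ → ℕ) ]
    (∀ n → n ≥ 1 → HasSize (λ ω → TwoSidedPrudentPolygon ω × HasArea ω n) (PA n))
    × genFun PA ≗ ((+ 2 · q) / (𝟏 ⊖ + 2 · q) [ refl ]) ⊕ ((+ 2 · q) / (𝟏 ⊖ q) [ refl ])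
    × (∀ n → n ≥ 1 → PA n ≡ 2 ^ n + 2)
proposition1 = (λ n → 2 ^ n + 2) ,
  (λ { (suc n) _ → polygons n , unique-polygons n , length-polygons n ,
                   λ ω → mk⇔ (∈-polygons⁻ n) (∈-polygons⁺ n) }) ,
  series , λ _ _ → refl
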